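{- Let $q$ be a prime power and let $k\ge 2$. Then $$\lim_{m+n\to\infty}\frac{P_k(m;n)}{N_k(m)N_k(n)}=1,$$ where $m,n$ range over the nonnegative integers.
   Context: $\mathbb F_q$ is the finite field with $q$ elements. Two polynomials in $\mathbb F_q[x_1,\dots,x_k]$ are identified if they differ by a factor in $\mathbb F_q^\times$; the classes are called normalized polynomials. For an integer $m\ge 0$, $\mathcal N_k(m)$ is the set of normalized (nonzero) polynomials in $\mathbb F_q[x_1,\dots,x_k]$ of total degree $m$, and $N_k(m)=|\mathcal N_k(m)|$. For $m,n\ge 0$, $P_k(m;n)=|\{(f,g)\in\mathcal N_k(m)\times\mathcal N_k(n):\gcd(f,g)=1\}|$. -}

module Defs where

open import Level using (_⊔_)
import Level
open import Algebra.Bundles using (CommutativeRing; RawSemiring)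
import Algebra.Definitions as AlgebraDefinitions
import Algebra.Definitions.RawSemiring as RawSemiringDefinitions
open import Data.Bool.Base using (if_then_else_)
open import Data.Empty using (⊥-elim)
open import Data.Fin.Base using (Fin)
open import Data.Integer.Base using (+_)
open import Data.List.Base using (List; []; _∷_; [_]; map; foldr; upTo; cartesianProductWith)
open import Data.Nat.Base as ℕ using (ℕ; zero; suc; NonZero; z≤n; s≤s)
import Data.Nat.Properties as ℕ
open import Data.Nat.Primality using (Prime)
open import Data.Product using (Σ-syntax; ∃; ∃₂; ∃-syntax; _×_; _,_; proj₁; proj₂)
open import Data.Product.Relation.Binary.Pointwise.NonDependent using (_×ₛ_)
open import Data.Rational.Base as ℚ using (ℚ)
open import Data.Sum.Base using (_⊎_; inj₁; inj₂)
open import Data.Vec.Base as Vec using (Vec; []; _∷_; replicate; zipWith)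
open import Data.Vec.Properties using (≡-dec)
open import Function.Bundles using (Inverse)
open import Relation.Binary.Bundles using (Setoid)
open import Relation.Binary.Construct.On as On using ()
open import Relation.Binary.PropositionalEquality as ≡ using (_≡_)
open import Relation.Nullary using (¬_; Dec; does; yes; no)

PrimePower : ℕ → Set
PrimePower q = ∃₂ λ p r → Prime p × 1 ℕ.≤ r × q ≡ p ℕ.^ r

-- n counts the equivalence classes of S, not the elements of its carrier.
HasSize : ∀ {a b} → Setoid a b → ℕ → Set (a ⊔ b)
HasSize S n = Inverse (≡.setoid (Fin n)) S

Finite : ∀ {a b} → Setoid a b → Set (a ⊔ b)
Finite S = ∃ (HasSize S)

size : ∀ {a b} {S : Setoid a b} → Finite S → ℕ
size = proj₁

size-nonZero : ∀ {a b} {S : Setoid a b} (fin : Finite S) →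
               Setoid.Carrier S → NonZero (size {S = S} fin)
size-nonZero (zero  , inv) x with Inverse.from inv x
... | ()
size-nonZero (suc n , inv) x = _

record Field c ℓ : Set (Level.suc (c ⊔ ℓ)) where
  field
    commutativeRing : CommutativeRing c ℓ
  open CommutativeRing commutativeRing public
  open AlgebraDefinitions _≈_ using (Invertible)
  field
    1≉0        : 1# ≉ 0#
    invertible : ∀ {x} → x ≉ 0# → Invertible 1# _*_ x

Monomial : ℕ → Set
Monomial k = Vec ℕ k

∣_∣ : ∀ {k} → Monomial k → ℕ
∣ α ∣ = Vec.sum α

_∸ₘ_ : ∀ {k} → Monomial k → Monomial k → Monomial k
_∸ₘ_ = zipWith ℕ._∸_

-- All β with βᵢ ≤ αᵢ for every i, each listed once, so that the products
-- β · (α ∸ₘ β) are exactly the factorizations of the monomial α.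
divisors : ∀ {k} → Monomial k → List (Monomial k)
divisors []      = [ [] ]
divisors (a ∷ α) = cartesianProductWith _∷_ (upTo (suc a)) (divisors α)

∣∣-∸ₘ : ∀ {k} (α β : Monomial k) → ∣ α ∣ ℕ.≤ ∣ β ∣ ℕ.+ ∣ α ∸ₘ β ∣
∣∣-∸ₘ []      []      = z≤n
∣∣-∸ₘ (a ∷ α) (b ∷ β) = begin
  a ℕ.+ ∣ α ∣
    ≤⟨ ℕ.+-mono-≤ (ℕ.m≤n+m∸n a b) (∣∣-∸ₘ α β) ⟩
  (b ℕ.+ (a ℕ.∸ b)) ℕ.+ (∣ β ∣ ℕ.+ ∣ α ∸ₘ β ∣)
    ≡⟨ ℕ.+-assoc b (a ℕ.∸ b) _ ⟩
  b ℕ.+ ((a ℕ.∸ b) ℕ.+ (∣ β ∣ ℕ.+ ∣ α ∸ₘ β ∣))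
    ≡⟨ ≡.cong (b ℕ.+_) (≡.sym (ℕ.+-assoc (a ℕ.∸ b) ∣ β ∣ _)) ⟩
  b ℕ.+ (((a ℕ.∸ b) ℕ.+ ∣ β ∣) ℕ.+ ∣ α ∸ₘ β ∣)
    ≡⟨ ≡.cong (λ t → b ℕ.+ (t ℕ.+ ∣ α ∸ₘ β ∣)) (ℕ.+-comm (a ℕ.∸ b) ∣ β ∣) ⟩
  b ℕ.+ ((∣ β ∣ ℕ.+ (a ℕ.∸ b)) ℕ.+ ∣ α ∸ₘ β ∣)
    ≡⟨ ≡.cong (b ℕ.+_) (ℕ.+-assoc ∣ β ∣ (a ℕ.∸ b) _) ⟩
  b ℕ.+ (∣ β ∣ ℕ.+ ((a ℕ.∸ b) ℕ.+ ∣ α ∸ₘ β ∣))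
    ≡⟨ ≡.sym (ℕ.+-assoc b ∣ β ∣ _) ⟩
  (b ℕ.+ ∣ β ∣) ℕ.+ ((a ℕ.∸ b) ℕ.+ ∣ α ∸ₘ β ∣) ∎
  where open ℕ.≤-Reasoning

split : ∀ {d e s b c} → d ℕ.+ e ℕ.< s → s ℕ.≤ b ℕ.+ c → d ℕ.< b ⊎ e ℕ.< c
split {d} {e} {s} {b} {c} d+e<s s≤b+c with d ℕ.<? b
... | yes d<b = inj₁ d<b
... | no  d≮b with e ℕ.<? c
...   | yes e<c = inj₂ e<c
...   | no  e≮c = ⊥-elim (ℕ.<⇒≱ d+e<s
          (ℕ.≤-trans s≤b+c (ℕ.+-mono-≤ (ℕ.≮⇒≥ d≮b) (ℕ.≮⇒≥ e≮c))))

_≟ₘ_ : ∀ {k} (α β : Monomial k) → Dec (α ≡ β)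
_≟ₘ_ = ≡-dec ℕ._≟_

module Polynomials {c ℓ} (F : Field c ℓ) (k : ℕ) where

  private module F = Field F

  -- A family of coefficients indexed by all monomials, which vanishes in
  -- all sufficiently large degrees. The bound is not required to be sharp
  -- and is ignored by the equality of polynomials.
  record Polynomial : Set (c ⊔ ℓ) where
    field
      coeff    : Monomial k → F.Carrier
      bound    : ℕ
      vanishes : ∀ α → bound ℕ.< ∣ α ∣ → coeff α F.≈ F.0#
  open Polynomial public

  infix  4 _≈ₚ_
  infixl 6 _+ₚ_
  infixl 7 _*ₚ_ _·_

  _≈ₚ_ : Polynomial → Polynomial → Set ℓ
  f ≈ₚ g = ∀ α → coeff f α F.≈ coeff g α

  sum : List F.Carrier → F.Carrier
  sum = foldr F._+_ F.0#

  sum-zero : ∀ (t : Monomial k → F.Carrier) → (∀ β → t β F.≈ F.0#) →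
             ∀ βs → sum (map t βs) F.≈ F.0#
  sum-zero t t≈0 []       = F.refl
  sum-zero t t≈0 (β ∷ βs) =
    F.trans (F.+-cong (t≈0 β) (sum-zero t t≈0 βs)) (F.+-identityˡ F.0#)

  _·_ : F.Carrier → Polynomial → Polynomial
  a · f = record
    { coeff    = λ α → a F.* coeff f α
    ; bound    = bound f
    ; vanishes = λ α lt → F.trans (F.*-congˡ (vanishes f α lt)) (F.zeroʳ a)
    }

  0ₚ : Polynomial
  0ₚ = record { coeff = λ _ → F.0# ; bound = 0 ; vanishes = λ _ _ → F.refl }

  indicator : ∀ {p} {P : Set p} → Dec P → F.Carrier
  indicator P? = if does P? then F.1# else F.0#

  indicator-yes : ∀ {p} {P : Set p} (P? : Dec P) → P → indicator P? F.≈ F.1#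
  indicator-yes (yes _) _ = F.refl
  indicator-yes (no ¬p) p = ⊥-elim (¬p p)

  indicator-no : ∀ {p} {P : Set p} (P? : Dec P) → ¬ P → indicator P? F.≈ F.0#
  indicator-no (yes p) ¬p = ⊥-elim (¬p p)
  indicator-no (no _)  _  = F.refl

  monomial : Monomial k → Polynomial
  monomial μ = record
    { coeff    = λ α → indicator (α ≟ₘ μ)
    ; bound    = ∣ μ ∣
    ; vanishes = λ α lt → indicator-no (α ≟ₘ μ)
        (λ α≡μ → ℕ.<⇒≢ lt (≡.cong ∣_∣ (≡.sym α≡μ)))
    }

  1ₚ : Polynomial
  1ₚ = monomial (replicate k 0)

  _+ₚ_ : Polynomial → Polynomial → Polynomial
  f +ₚ g = record
    { coeff    = λ α → coeff f α F.+ coeff g α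
    ; bound    = bound f ℕ.⊔ bound g
    ; vanishes = λ α lt → F.trans
        (F.+-cong (vanishes f α (ℕ.≤-<-trans (ℕ.m≤m⊔n (bound f) (bound g)) lt))
                  (vanishes g α (ℕ.≤-<-trans (ℕ.m≤n⊔m (bound f) (bound g)) lt)))
        (F.+-identityˡ F.0#)
    }

  _*ₚ_ : Polynomial → Polynomial → Polynomial
  f *ₚ g = record
    { coeff    = λ α → sum (map (term α) (divisors α))
    ; bound    = bound f ℕ.+ bound g
    ; vanishes = λ α lt → sum-zero (term α) (term-zero α lt) (divisors α)
    }
    where
    term : Monomial k → Monomial k → F.Carrier
    term α β = coeff f β F.* coeff g (α ∸ₘ β)

    term-zero : ∀ α → bound f ℕ.+ bound g ℕ.< ∣ α ∣ → ∀ β → term α β F.≈ F.0#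
    term-zero α lt β with split lt (∣∣-∸ₘ α β)
    ... | inj₁ p = F.trans (F.*-congʳ (vanishes f β p)) (F.zeroˡ _)
    ... | inj₂ p = F.trans (F.*-congˡ (vanishes g (α ∸ₘ β) p)) (F.zeroʳ _)

  rawSemiring : RawSemiring (c ⊔ ℓ) ℓ
  rawSemiring = record
    { Carrier = Polynomial
    ; _≈_     = _≈ₚ_
    ; _+_     = _+ₚ_
    ; _*_     = _*ₚ_
    ; 0#      = 0ₚ
    ; 1#      = 1ₚ
    }

  -- Coprime f g says that 1ₚ is a greatest common divisor of f and g: every
  -- common divisor divides 1ₚ (and 1ₚ divides everything).
  open RawSemiringDefinitions rawSemiring public using (_∣_; Coprime)

  -- In particular f is nonzero.
  HasTotalDegree : Polynomial → ℕ → Set ℓ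
  HasTotalDegree f m =
    (∃[ α ] ∣ α ∣ ≡ m × coeff f α F.≉ F.0#) ×
    (∀ α → m ℕ.< ∣ α ∣ → coeff f α F.≈ F.0#)

  infix 4 _∼_

  _∼_ : Polynomial → Polynomial → Set (c ⊔ ℓ)
  f ∼ g = ∃[ a ] a F.≉ F.0# × f ≈ₚ a · g

  ∼-refl : ∀ {f} → f ∼ f
  ∼-refl = F.1# , F.1≉0 , λ α → F.sym (F.*-identityˡ _)

  ∼-sym : ∀ {f g} → f ∼ g → g ∼ f
  ∼-sym {f} {g} (a , a≉0 , f≈ag) with F.invertible a≉0
  ... | b , ba≈1 , _ = b , b≉0 , g≈bf
    where
    b≉0 : b F.≉ F.0#
    b≉0 b≈0 = F.1≉0 (F.trans (F.sym ba≈1) (F.trans (F.*-congʳ b≈0) (F.zeroˡ a)))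

    g≈bf : g ≈ₚ b · f
    g≈bf α = F.sym (F.trans (F.*-congˡ (f≈ag α)) (F.trans (F.sym (F.*-assoc b a _))
               (F.trans (F.*-congʳ ba≈1) (F.*-identityˡ _))))

  ∼-trans : ∀ {f g h} → f ∼ g → g ∼ h → f ∼ h
  ∼-trans (a , a≉0 , f≈ag) (b , b≉0 , g≈bh) =
    a F.* b , ab≉0 ,
    λ α → F.trans (f≈ag α) (F.trans (F.*-congˡ (g≈bh α)) (F.sym (F.*-assoc a b _)))
    where
    ab≉0 : a F.* b F.≉ F.0#
    ab≉0 ab≈0 with F.invertible a≉0
    ... | a⁻¹ , a⁻¹a≈1 , _ = b≉0 (F.trans (F.sym (F.*-identityˡ b))
            (F.trans (F.*-congʳ (F.sym a⁻¹a≈1)) (F.trans (F.*-assoc a⁻¹ a b)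
            (F.trans (F.*-congˡ ab≈0) (F.zeroʳ a⁻¹)))))

  normalized : Setoid (c ⊔ ℓ) (c ⊔ ℓ)
  normalized = record
    { Carrier       = Polynomial
    ; _≈_           = _∼_
    ; isEquivalence = record
        { refl  = λ {f} → ∼-refl {f}
        ; sym   = λ {f} {g} → ∼-sym {f} {g}
        ; trans = λ {f} {g} {h} → ∼-trans {f} {g} {h}
        }
    }

  𝒩 : ℕ → Setoid (c ⊔ ℓ) (c ⊔ ℓ)
  𝒩 m = On.setoid {B = Σ[ f ∈ Polynomial ] HasTotalDegree f m} normalized proj₁

  𝒫 : ℕ → ℕ → Setoid (c ⊔ ℓ) (c ⊔ ℓ)
  𝒫 m n = On.setoid
    {B = Σ[ (f , g) ∈ Setoid.Carrier (𝒩 m ×ₛ 𝒩 n) ] Coprime (proj₁ f) (proj₁ g)}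
    (𝒩 m ×ₛ 𝒩 n) proj₁

-- x₁ᵐ; it ensures that the denominators N(m) N(n) below are nonzero.
𝒩-inhabited : ∀ {c ℓ} (F : Field c ℓ) {k} → 1 ℕ.≤ k → ∀ m →
              Setoid.Carrier (Polynomials.𝒩 F k m)
𝒩-inhabited F {suc k} (s≤s _) m =
  monomial μ ,
  (μ , ∣μ∣≡m , nonzero) ,
  λ α lt → vanishes (monomial μ) α (≡.subst (ℕ._< ∣ α ∣) (≡.sym ∣μ∣≡m) lt)
  where
  open Polynomials F (suc k)
  module F = Field F

  μ : Monomial (suc k)
  μ = m ∷ replicate k 0

  ∣replicate∣ : ∀ j → ∣ replicate j 0 ∣ ≡ 0
  ∣replicate∣ zero    = ≡.refl
  ∣replicate∣ (suc j) = ∣replicate∣ j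

  ∣μ∣≡m : ∣ μ ∣ ≡ m
  ∣μ∣≡m = ≡.trans (≡.cong (m ℕ.+_) (∣replicate∣ k)) (ℕ.+-identityʳ m)

  nonzero : coeff (monomial μ) μ F.≉ F.0#
  nonzero eq = F.1≉0
    (F.trans (F.sym (indicator-yes (μ ≟ₘ μ) ≡.refl)) eq)

module _ {c ℓ} (F : Field c ℓ) {k} (2≤k : 2 ℕ.≤ k) where

  open Polynomials F k

  module Density (finite-𝒩 : ∀ m → Finite (𝒩 m))
                 (finite-𝒫 : ∀ m n → Finite (𝒫 m n)) where

    N : ℕ → ℕ
    N m = size {S = 𝒩 m} (finite-𝒩 m)

    P : ℕ → ℕ → ℕ
    P m n = size {S = 𝒫 m n} (finite-𝒫 m n)

    N-nonZero : ∀ m → NonZero (N m)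
    N-nonZero m =
      size-nonZero {S = 𝒩 m} (finite-𝒩 m) (𝒩-inhabited F (ℕ.<⇒≤ 2≤k) m)

    density : ℕ → ℕ → ℚ
    density m n = ℚ._/_ (+ P m n) (N m ℕ.* N n)
      {{ℕ.m*n≢0 (N m) (N n) {{N-nonZero m}} {{N-nonZero n}}}}

-- a m n → L as m + n → ∞.
Tends : (ℕ → ℕ → ℚ) → ℚ → Set
Tends a L = ∀ ε → ℚ.0ℚ ℚ.< ε →
  ∃[ M ] ∀ m n → M ℕ.≤ m ℕ.+ n → ℚ.∣ a m n ℚ.- L ∣ ℚ.< ε

{-# OPTIONS --safe #-}

-- A pair (f , g) of degrees (m , n) fails to be coprime only if
-- f = u h and g = v h with h of some degree d, 1 ≤ d ≤ min(m , n).
-- Let D(j) be the number of monomials of degree at most j in k variables; up to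
-- a factor q, N(j) is q ^ D(j), so at most q ^ (D(d) + D(m - d) + D(n - d))
-- pairs arise from each d. The increments of D are nondecreasing and, as k ≥ 2,
-- D(j) - D(j - 1) ≥ j + 1. Hence D is superadditive up to 1 and, with s either
-- of m and n,
--   D(d) + D(m - d) + D(n - d) + s ≤ D(m) + D(n),
-- so the proportion of such pairs is at most s q² / q ^ s, which is small when s
-- is the larger of m and n.
module Submission where

open import Defs
open import Algebra.Definitions.RawMagma using (_∣ʳ_)
open import Data.Empty using (⊥)
open import Data.Fin.Base as Fin using (Fin; zero; suc; toℕ; fromℕ<; _↑ˡ_; _↑ʳ_; splitAt; join; combine; remQuot; inject≤; finToFun; funToFin)
import Data.Fin.Properties as Fin
open import Data.Integer.Base as ℤ using (+_; -[1+_])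
import Data.Integer.Properties as ℤ
open import Data.List.Base as List using (List; []; _∷_; map; lookup; deduplicate; upTo)
open import Data.List.Membership.Propositional using (_∈_)
open import Data.List.Membership.Propositional.Properties using (∈-cartesianProductWith⁺; ∈-cartesianProductWith⁻; ∈-upTo⁺; ∈-upTo⁻; ∈-lookup)
open import Data.List.Relation.Unary.All as All using ([]; _∷_)
open import Data.List.Relation.Unary.AllPairs using ([]; _∷_)
open import Data.List.Relation.Unary.Any as Any using (Any; here; there)
open import Data.List.Relation.Unary.Any.Properties using (lookup-index)
import Data.List.Relation.Unary.Enumerates.Setoid as Enumerates
open import Data.List.Relation.Unary.Enumerates.Setoid.Properties using (deduplicate⁺)
open import Data.List.Relation.Unary.Unique.DecSetoid.Properties using (deduplicate-!)
open import Data.List.Relation.Unary.Unique.Propositional using (Unique)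
open import Data.List.Relation.Unary.Unique.Propositional.Properties using (cartesianProductWith⁺; upTo⁺)
import Data.List.Relation.Unary.Unique.Setoid as UniqueSetoid
open import Data.Nat.Base
open import Data.Nat.Properties
open import Algebra.Properties.CommutativeSemigroup +-commutativeSemigroup using (interchange; x∙yz≈y∙xz)
open import Data.Nat.Solver using (module +-*-Solver)
open import Data.Product using (Σ-syntax; ∃; ∃-syntax; _×_; _,_; proj₁; proj₂)
open import Data.Product.Relation.Binary.Pointwise.NonDependent using (_×ₛ_)
open import Data.Rational.Base as ℚ using (mkℚ; 0ℚ; 1ℚ; toℚᵘ)
import Data.Rational.Properties as ℚ
open import Data.Rational.Unnormalised.Base as ℚᵘ using (mkℚᵘ; 1ℚᵘ)
import Data.Rational.Unnormalised.Properties as ℚᵘ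
open import Data.Sum.Base as Sum using (_⊎_; inj₁; inj₂; [_,_]′)
open import Data.Sum.Properties using (inj₁-injective; inj₂-injective)
open import Data.Vec.Base using ([]; _∷_; replicate; zipWith)
open import Data.Vec.Properties using (∷-injective)
open import Function.Base using (_∘_)
open import Function.Bundles using (Inverse)
open import Relation.Binary.Bundles using (Setoid; DecSetoid)
open import Relation.Binary.Definitions using (Decidable; Transitive; tri<; tri≈; tri>)
open import Relation.Binary.PropositionalEquality using (_≡_; _≢_; refl; sym; trans; cong; cong₂; subst; subst₂)
open import Relation.Nullary using (¬_; Dec; yes; no; contradiction)
open import Relation.Nullary.Decidable using (_×-dec_; _⊎-dec_; ¬?; map′; decidable-stable)
import Relation.Unary as Unary

-- In the limit one degree may stay bounded while the other grows, so the saving is measured in a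
-- single degree `s`, uniformly in the other one; `s` is whichever degree is forced to be large. The
-- finiteness of the set of coprime pairs is obtained by deciding coprimality, although `Coprime`
-- quantifies over all polynomials. This decision and the counting rest on the same dichotomy: a
-- pair either is coprime or has a common factor that a search through finitely many codes finds.
-- Every inequality between counts is an injection between finite sets. One triple (h, u, v) is
-- chosen for each pair that is not coprime, and multiplication recovers the pair from it. The q²
-- comes from the two lower bounds q ^ D(j) ≤ q N(j), one for each degree.

n<2^n : ∀ n → n < 2 ^ n
n<2^n zero    = s≤s z≤n
n<2^n (suc n) = begin
  suc (suc n)             ≤⟨ s≤s (n<2^n n) ⟩
  suc (2 ^ n)             ≤⟨ +-monoˡ-≤ (2 ^ n) (m^n>0 2 n) ⟩
  2 ^ n + 2 ^ n           ≡⟨ cong (λ t → 2 ^ n + t) (+-identityʳ (2 ^ n)) ⟨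
  2 ^ suc n               ∎
  where open ≤-Reasoning

-- With s = c + t the hypothesis says c² ≤ t. Then c s = c² + c t is less than (c + 1)(t + 1), and
-- each of these factors is at most a power of 2.
linear<2^ : ∀ c {s} → c + c * c ≤ s → c * s < 2 ^ s
linear<2^ c {s} c+cc≤s with m≤n⇒∃[o]m+o≡n (m+n≤o⇒m≤o c c+cc≤s)
... | t , refl = begin-strict
  c * (c + t)       ≡⟨ *-distribˡ-+ c c t ⟩
  c * c + c * t     <⟨ +-mono-<-≤ (s≤s (+-cancelˡ-≤ c _ _ c+cc≤s)) (*-monoʳ-≤ c (n≤1+n t)) ⟩
  suc c * suc t     ≤⟨ *-mono-≤ (n<2^n c) (n<2^n t) ⟩
  2 ^ c * 2 ^ t     ≡⟨ ^-distribˡ-+-* 2 c t ⟨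
  2 ^ (c + t)       ∎
  where open ≤-Reasoning

-- Multiplying by q ^ s turns the error term s * q ^ E into a multiple of N * N′.
defect-small : ∀ q {s E a b N N′ P} T → q ^ a ≤ q * N → q ^ b ≤ q * N′ → E + s ≡ a + b →
               .{{NonZero N}} → .{{NonZero N′}} →
               N * N′ ≤ P + s * q ^ E → (T * (q * q)) * s < q ^ s → T * (N * N′) < T * P + N * N′
defect-small q {s} {E} {a} {b} {N} {N′} {P} T qᵃ≤ qᵇ≤ E+s≡a+b X≤ small =
  *-cancelˡ-< (q ^ s) _ _ (begin-strict
    q ^ s * (T * X)
      ≤⟨ *-monoʳ-≤ (q ^ s) (*-monoʳ-≤ T X≤) ⟩
    q ^ s * (T * (P + s * q ^ E))
      ≡⟨ solve 5 (λ A T P s Q → A :* (T :* (P :+ s :* Q)) := A :* (T :* P) :+ (T :* s) :* (Q :* A)) refl (q ^ s) T P s (q ^ E) ⟩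
    q ^ s * (T * P) + (T * s) * (q ^ E * q ^ s)
      ≤⟨ +-monoʳ-≤ (q ^ s * (T * P)) (*-monoʳ-≤ (T * s) power≤) ⟩
    q ^ s * (T * P) + (T * s) * ((q * q) * X)
      ≡⟨ cong (λ t → q ^ s * (T * P) + t) 
           (solve 4 (λ T s q X → (T :* s) :* ((q :* q) :* X) := ((T :* (q :* q)) :* s) :* X) refl T s q X) ⟩
    q ^ s * (T * P) + ((T * (q * q)) * s) * X
      <⟨ +-monoʳ-< (q ^ s * (T * P)) (*-monoˡ-< X {{m*n≢0 N N′}} small) ⟩
    q ^ s * (T * P) + q ^ s * X
      ≡⟨ *-distribˡ-+ (q ^ s) (T * P) X ⟨
    q ^ s * (T * P + X) ∎)
  where
  open ≤-Reasoning
  open +-*-Solver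

  X : ℕ
  X = N * N′

  power≤ : q ^ E * q ^ s ≤ (q * q) * X
  power≤ = begin
    q ^ E * q ^ s          ≡⟨ ^-distribˡ-+-* q E s ⟨
    q ^ (E + s)            ≡⟨ cong (q ^_) E+s≡a+b ⟩
    q ^ (a + b)            ≡⟨ ^-distribˡ-+-* q a b ⟩
    q ^ a * q ^ b          ≤⟨ *-mono-≤ qᵃ≤ qᵇ≤ ⟩
    (q * N) * (q * N′)     ≡⟨ [m*n]*[o*p]≡[m*o]*[n*p] q N q N′ ⟩
    (q * q) * X            ∎

-- The numerator of a positive ε is at least 1, so it suffices to bring 1 - P / X below the
-- reciprocal of the denominator of ε. The last hypothesis is this bound cleared of fractions.
∣P/X-1∣<ε : ∀ {ε} → 0ℚ ℚ.< ε → ∀ {P X} .{{_ : NonZero X}} → P ≤ X →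
            ℚ.↧ₙ ε * X < ℚ.↧ₙ ε * P + X → ℚ.∣ (+ P ℚ./ X) ℚ.- 1ℚ ∣ ℚ.< ε
∣P/X-1∣<ε {mkℚ (+ zero)  _ _} (ℚ.*<* (ℤ.+<+ ()))
∣P/X-1∣<ε {mkℚ -[1+ _ ]  _ _} (ℚ.*<* ())
∣P/X-1∣<ε {ε@(mkℚ (+ suc a) b _)} _ {P} {X@(suc x)} P≤X small =
  ℚ.toℚᵘ-cancel-< (ℚᵘ.<-respˡ-≃ (ℚᵘ.≃-sym toℚᵘ-distance) (ℚᵘ.*<* (begin-strict
    + ℤ.∣ + P ℤ.* + 1 ℤ.+ -[1+ 0 ] ℤ.* + X ∣ ℤ.* + suc b
      ≡⟨ cong (λ t → + t ℤ.* + suc b) numerator ⟩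
    + (X ∸ P) ℤ.* + suc b
      ≡⟨ ℤ.pos-* (X ∸ P) (suc b) ⟨
    + ((X ∸ P) * suc b)
      <⟨ ℤ.+<+ defect ⟩
    + (suc a * (X * 1))
      ≡⟨ ℤ.pos-* (suc a) (X * 1) ⟩
    + suc a ℤ.* + (X * 1) ∎)))
  where
  open ℤ.≤-Reasoning

  toℚᵘ-distance : toℚᵘ ℚ.∣ (+ P ℚ./ X) ℚ.- 1ℚ ∣ ℚᵘ.≃ ℚᵘ.∣ mkℚᵘ (+ P) x ℚᵘ.- 1ℚᵘ ∣
  toℚᵘ-distance = ℚᵘ.≃-trans (ℚ.toℚᵘ-homo-∣-∣ ((+ P ℚ./ X) ℚ.- 1ℚ)) (ℚᵘ.∣-∣-cong
    (ℚᵘ.≃-trans (ℚ.toℚᵘ-homo-+ (+ P ℚ./ X) (ℚ.- 1ℚ))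
      (ℚᵘ.+-congˡ (ℚᵘ.- 1ℚᵘ) (ℚ.toℚᵘ-fromℚᵘ (mkℚᵘ (+ P) x)))))

  numerator : ℤ.∣ + P ℤ.* + 1 ℤ.+ -[1+ 0 ] ℤ.* + X ∣ ≡ X ∸ P
  numerator = trans (cong₂ (λ i j → ℤ.∣ i ℤ.+ j ∣) (ℤ.*-identityʳ (+ P)) (ℤ.-1*i≡-i (+ X)))
    (trans (cong ℤ.∣_∣ (ℤ.m-n≡m⊖n P X)) (ℤ.∣⊖∣-≤ P≤X))

  defect : (X ∸ P) * suc b < suc a * (X * 1)
  defect = ≤-trans (subst (_< X) (trans (sym (*-distribˡ-∸ (suc b) X P)) (*-comm (suc b) (X ∸ P)))
      (m<n+o⇒m∸n<o (suc b * X) (suc b * P) small))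
    (≤-trans (≤-reflexive (sym (*-identityʳ X))) (m≤m+n (X * 1) (a * (X * 1))))

-- Monomials

private variable
  k : ℕ

-- The binomial coefficient C(m + k, k), which counts the monomials of degree at most m. Pascal's
-- recursion separates the monomials free of the first variable from its multiples, so the
-- increments in m are values of the same function with one variable fewer.
#monomials : ℕ → ℕ → ℕ
#monomials zero    m       = 1
#monomials (suc k) zero    = #monomials k zero
#monomials (suc k) (suc m) = #monomials k (suc m) + #monomials (suc k) m

incrementHead : Monomial (suc k) → Monomial (suc k)
incrementHead (a ∷ α) = suc a ∷ α

monomialAt : ∀ k m → Fin (#monomials k m) → Monomial k
monomialAt zero    m       _ = []
monomialAt (suc k) zero    i = 0 ∷ monomialAt k 0 i
monomialAt (suc k) (suc m) i =
  [ (λ j → 0 ∷ monomialAt k (suc m) j)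
  , (λ j → incrementHead (monomialAt (suc k) m j))
  ]′ (splitAt (#monomials k (suc m)) i)

indexOf : ∀ m (α : Monomial k) → ∣ α ∣ ≤ m → Fin (#monomials k m)
indexOf         m       []          _       = zero
indexOf         zero    (zero ∷ α)  p       = indexOf 0 α p
indexOf {suc k} (suc m) (zero ∷ α)  p       = indexOf (suc m) α p ↑ˡ #monomials (suc k) m
indexOf {suc k} (suc m) (suc a ∷ α) (s≤s p) = #monomials k (suc m) ↑ʳ indexOf m (a ∷ α) p

monomialAt-indexOf : ∀ m (α : Monomial k) (p : ∣ α ∣ ≤ m) → monomialAt k m (indexOf m α p) ≡ α
monomialAt-indexOf         m       []          _       = refl
monomialAt-indexOf         zero    (zero ∷ α)  p       = cong (0 ∷_) (monomialAt-indexOf 0 α p)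
monomialAt-indexOf {suc k} (suc m) (zero ∷ α)  p
  rewrite Fin.splitAt-↑ˡ (#monomials k (suc m)) (indexOf (suc m) α p) (#monomials (suc k) m) =
  cong (0 ∷_) (monomialAt-indexOf (suc m) α p)
monomialAt-indexOf {suc k} (suc m) (suc a ∷ α) (s≤s p)
  rewrite Fin.splitAt-↑ʳ (#monomials k (suc m)) (#monomials (suc k) m) (indexOf m (a ∷ α) p) =
  cong incrementHead (monomialAt-indexOf m (a ∷ α) p)

∣incrementHead∣ : (α : Monomial (suc k)) → ∣ incrementHead α ∣ ≡ suc ∣ α ∣
∣incrementHead∣ (a ∷ α) = refl

∣monomialAt∣ : ∀ k m i → ∣ monomialAt k m i ∣ ≤ m
∣monomialAt∣ zero    m       i = z≤n
∣monomialAt∣ (suc k) zero    i = ∣monomialAt∣ k 0 i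
∣monomialAt∣ (suc k) (suc m) i with splitAt (#monomials k (suc m)) i
... | inj₁ j = ∣monomialAt∣ k (suc m) j
... | inj₂ j = ≤-trans (≤-reflexive (∣incrementHead∣ (monomialAt (suc k) m j)))
                       (s≤s (∣monomialAt∣ (suc k) m j))

indexOf-incrementHead : ∀ m (α : Monomial (suc k)) (p : ∣ α ∣ ≤ m) (p⁺ : ∣ incrementHead α ∣ ≤ suc m) →
                        indexOf (suc m) (incrementHead α) p⁺ ≡ #monomials k (suc m) ↑ʳ indexOf m α p
indexOf-incrementHead {k} m (a ∷ α) p (s≤s p⁺) =
  cong (λ r → #monomials k (suc m) ↑ʳ indexOf m (a ∷ α) r) (≤-irrelevant p⁺ p)

indexOf-monomialAt : ∀ k m i (p : ∣ monomialAt k m i ∣ ≤ m) → indexOf m (monomialAt k m i) p ≡ i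
indexOf-monomialAt zero    m       zero p = refl
indexOf-monomialAt (suc k) zero    i    p = indexOf-monomialAt k 0 i p
indexOf-monomialAt (suc k) (suc m) i    p with splitAt (#monomials k (suc m)) i in eq
... | inj₁ j = trans (cong (_↑ˡ #monomials (suc k) m) (indexOf-monomialAt k (suc m) j p))
                     (Fin.splitAt⁻¹-↑ˡ eq)
... | inj₂ j = trans
  (indexOf-incrementHead m (monomialAt (suc k) m j) (∣monomialAt∣ (suc k) m j) p)
  (trans (cong (#monomials k (suc m) ↑ʳ_)
            (indexOf-monomialAt (suc k) m j (∣monomialAt∣ (suc k) m j)))
         (Fin.splitAt⁻¹-↑ʳ eq))

#monomials-zero : ∀ k → #monomials k 0 ≡ 1
#monomials-zero zero    = refl
#monomials-zero (suc k) = #monomials-zero k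

#monomials-step : ∀ k m → #monomials k m ≤ #monomials k (suc m)
#monomials-step zero    m = ≤-refl
#monomials-step (suc k) m = m≤n+m _ _

#monomials-monoʳ : ∀ k {m n} → m ≤ n → #monomials k m ≤ #monomials k n
#monomials-monoʳ k m≤n = go (≤⇒≤′ m≤n)
  where
  go : ∀ {m n} → m ≤′ n → #monomials k m ≤ #monomials k n
  go ≤′-refl       = ≤-refl
  go (≤′-step m≤n) = ≤-trans (go m≤n) (#monomials-step k _)

-- The powers of one variable already account for m + 1 monomials. With one variable fewer this
-- bounds the increments of `#monomials`, which is where two variables are required.
#monomials-lower : ∀ {k} → 1 ≤ k → ∀ m → suc m ≤ #monomials k m
#monomials-lower {suc k} 1≤k zero = ≤-reflexive (sym (#monomials-zero (suc k)))
#monomials-lower {suc k} 1≤k (suc m) = +-mono-≤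
  (≤-trans (≤-reflexive (sym (#monomials-zero k))) (#monomials-monoʳ k z≤n))
  (#monomials-lower (s≤s z≤n) m)

-- Raising d by 1 adds `#monomials k (suc d)` on the left and the larger `#monomials k (suc d + e)`
-- on the right. The outer `suc` is the value at degree 0, where equality holds.
#monomials-superadditive : ∀ k d e → #monomials (suc k) d + #monomials (suc k) e ≤ suc (#monomials (suc k) (d + e))
#monomials-superadditive k zero    e = ≤-reflexive (cong (_+ #monomials (suc k) e) (#monomials-zero k))
#monomials-superadditive k (suc d) e = begin
  (#monomials k (suc d) + #monomials (suc k) d) + #monomials (suc k) e
    ≡⟨ +-assoc (#monomials k (suc d)) _ _ ⟩
  #monomials k (suc d) + (#monomials (suc k) d + #monomials (suc k) e)
    ≤⟨ +-mono-≤ (#monomials-monoʳ k (m≤m+n (suc d) e)) (#monomials-superadditive k d e) ⟩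
  #monomials k (suc d + e) + suc (#monomials (suc k) (d + e))
    ≡⟨ +-suc _ _ ⟩
  suc (#monomials (suc k) (suc d + e)) ∎
  where open ≤-Reasoning

-- Superadditivity merges d with n - d at the cost of 1. Since d ≥ 1, the remaining term is at most
-- D(m - 1), and the increment D(m) - D(m - 1) ≥ m + 1 pays for both m and that 1.
#monomials-factor : ∀ {k} → 2 ≤ k → ∀ {d m n} → 1 ≤ d → d ≤ m → d ≤ n →
  (#monomials k d + (#monomials k (m ∸ d) + #monomials k (n ∸ d))) + m ≤ #monomials k m + #monomials k n
#monomials-factor {suc k} (s≤s 1≤k) {suc d} {suc m} {n} 1≤d d≤m d≤n = begin
  (D (suc d) + (D (m ∸ d) + D (n ∸ suc d))) + suc m
    ≡⟨ cong (λ t → t + suc m) (x∙yz≈y∙xz (D (suc d)) (D (m ∸ d)) (D (n ∸ suc d))) ⟩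
  (D (m ∸ d) + (D (suc d) + D (n ∸ suc d))) + suc m
    ≤⟨ +-monoˡ-≤ (suc m) (+-mono-≤ (#monomials-monoʳ (suc k) (m∸n≤m m d)) (#monomials-superadditive k (suc d) (n ∸ suc d))) ⟩
  (D m + suc (D (suc d + (n ∸ suc d)))) + suc m
    ≡⟨ cong (λ t → (D m + suc (D t)) + suc m) (m+[n∸m]≡n d≤n) ⟩
  (D m + suc (D n)) + suc m
    ≡⟨ cong (λ t → t + suc m) (+-suc (D m) (D n)) ⟩
  suc (D m + D n) + suc m
    ≡⟨ +-comm (suc (D m + D n)) (suc m) ⟩
  suc m + suc (D m + D n)
    ≡⟨ +-suc (suc m) _ ⟩
  suc (suc m) + (D m + D n)
    ≤⟨ +-monoˡ-≤ _ (#monomials-lower 1≤k (suc m)) ⟩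
  #monomials k (suc m) + (D m + D n)
    ≡⟨ +-assoc _ (D m) (D n) ⟨
  D (suc m) + D n ∎
  where
  open ≤-Reasoning
  D = #monomials (suc k)

infixl 6 _+ₘ_
_+ₘ_ : Monomial k → Monomial k → Monomial k
_+ₘ_ = zipWith _+_

∣∣-+ₘ : (α β : Monomial k) → ∣ α +ₘ β ∣ ≡ ∣ α ∣ + ∣ β ∣
∣∣-+ₘ []      []      = refl
∣∣-+ₘ (a ∷ α) (b ∷ β) = trans (cong (λ t → a + b + t) (∣∣-+ₘ α β)) (interchange a b ∣ α ∣ ∣ β ∣)

∣∣≡0 : (α : Monomial k) → ∣ α ∣ ≡ 0 → α ≡ replicate k 0
∣∣≡0 []         _ = refl
∣∣≡0 (zero ∷ α) p = cong (0 ∷_) (∣∣≡0 α p)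

α+ₘβ∸ₘα≡β : (α β : Monomial k) → (α +ₘ β) ∸ₘ α ≡ β
α+ₘβ∸ₘα≡β []      []      = refl
α+ₘβ∸ₘα≡β (a ∷ α) (b ∷ β) = cong₂ _∷_ (m+n∸m≡n a b) (α+ₘβ∸ₘα≡β α β)

divisor-complement : (γ : Monomial k) → ∀ {β} → β ∈ divisors γ → β +ₘ (γ ∸ₘ β) ≡ γ
divisor-complement []      {[]} _ = refl
divisor-complement (c ∷ γ) {β}  β∈
  with b , β′ , b∈ , β′∈ , refl ← ∈-cartesianProductWith⁻ _∷_ (upTo (suc c)) (divisors γ) β∈ =
  cong₂ _∷_ (m+[n∸m]≡n (s≤s⁻¹ (∈-upTo⁻ b∈))) (divisor-complement γ β′∈)

∈-divisors : (α β : Monomial k) → α ∈ divisors (α +ₘ β)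
∈-divisors []      []      = here refl
∈-divisors (a ∷ α) (b ∷ β) = ∈-cartesianProductWith⁺ _∷_ (∈-upTo⁺ (s≤s (m≤m+n a b))) (∈-divisors α β)

divisors-unique : (α : Monomial k) → Unique (divisors α)
divisors-unique []      = [] ∷ []
divisors-unique (a ∷ α) = cartesianProductWith⁺ _∷_ ∷-injective (upTo⁺ (suc a)) (divisors-unique α)

-- The graded lexicographic order

infix 4 _<ₗₑₓ_ _<ₘ_

_<ₗₑₓ_ : Monomial k → Monomial k → Set
[]      <ₗₑₓ []      = ⊥
(a ∷ α) <ₗₑₓ (b ∷ β) = a < b ⊎ (a ≡ b × α <ₗₑₓ β)

<ₗₑₓ-irrefl : (α : Monomial k) → ¬ (α <ₗₑₓ α)
<ₗₑₓ-irrefl (a ∷ α) (inj₁ a<a)       = <-irrefl refl a<a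
<ₗₑₓ-irrefl (a ∷ α) (inj₂ (_ , α<α)) = <ₗₑₓ-irrefl α α<α

<ₗₑₓ-trans : (α β γ : Monomial k) → α <ₗₑₓ β → β <ₗₑₓ γ → α <ₗₑₓ γ
<ₗₑₓ-trans []      []      []      ()                  _
<ₗₑₓ-trans (a ∷ α) (b ∷ β) (c ∷ γ) (inj₁ a<b)          (inj₁ b<c)          = inj₁ (<-trans a<b b<c)
<ₗₑₓ-trans (a ∷ α) (b ∷ β) (c ∷ γ) (inj₁ a<b)          (inj₂ (refl , _))   = inj₁ a<b
<ₗₑₓ-trans (a ∷ α) (b ∷ β) (c ∷ γ) (inj₂ (refl , _))   (inj₁ b<c)          = inj₁ b<c
<ₗₑₓ-trans (a ∷ α) (b ∷ β) (c ∷ γ) (inj₂ (refl , α<β)) (inj₂ (refl , β<γ)) = inj₂ (refl , <ₗₑₓ-trans α β γ α<β β<γ)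

_<ₗₑₓ?_ : Decidable (_<ₗₑₓ_ {k})
[]      <ₗₑₓ? []      = no λ ()
(a ∷ α) <ₗₑₓ? (b ∷ β) = (a <? b) ⊎-dec ((a ≟ b) ×-dec (α <ₗₑₓ? β))

-- At the first exponent where two factorizations of one monomial differ, the sums agree, so the
-- exponent of one of the two factors must rise.
<ₗₑₓ-+ₘ : (α β α′ β′ : Monomial k) → α′ +ₘ β′ ≡ α +ₘ β →
          α′ ≡ α ⊎ (α <ₗₑₓ α′ ⊎ β <ₗₑₓ β′)
<ₗₑₓ-+ₘ []      []      []        []        _  = inj₁ refl
<ₗₑₓ-+ₘ (a ∷ α) (b ∷ β) (a′ ∷ α′) (b′ ∷ β′) eq
  with eqₕ , eqₜ ← ∷-injective eq with <-cmp a a′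
... | tri< a<a′ _ _ = inj₂ (inj₁ (inj₁ a<a′))
... | tri> _ _ a′<a = inj₂ (inj₂ (inj₁ (≰⇒> λ b′≤b → <⇒≢ (+-mono-<-≤ a′<a b′≤b) eqₕ)))
... | tri≈ _ refl _ with refl ← +-cancelˡ-≡ a b′ b eqₕ =
  Sum.map (cong (a ∷_)) (Sum.map (λ lt → inj₂ (refl , lt)) (λ lt → inj₂ (refl , lt)))
    (<ₗₑₓ-+ₘ α β α′ β′ eqₜ)

-- With the degree in front as one more exponent, the graded order is the plain lexicographic order
-- in k + 1 variables and inherits its properties. Comparing degrees first lets the leading monomial
-- carry the total degree.
graded : Monomial k → Monomial (suc k)
graded α = ∣ α ∣ ∷ α

_<ₘ_ : Monomial k → Monomial k → Set
α <ₘ β = graded α <ₗₑₓ graded β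

<ₘ-+ₘ : (α β α′ β′ : Monomial k) → α′ +ₘ β′ ≡ α +ₘ β → α′ ≡ α ⊎ (α <ₘ α′ ⊎ β <ₘ β′)
<ₘ-+ₘ α β α′ β′ eq = Sum.map₁ (λ e → proj₂ (∷-injective e))
  (<ₗₑₓ-+ₘ (graded α) (graded β) (graded α′) (graded β′)
    (cong₂ _∷_ (trans (sym (∣∣-+ₘ α′ β′)) (trans (cong ∣_∣ eq) (∣∣-+ₘ α β))) eq))

-- The choice made in the tail is kept unless it lies below `zero`; in that case transitivity shows
-- that no candidate of the tail lies above `zero`. Applied to the nonzero coefficients within the
-- bound, this finds a leading monomial.
maximal : ∀ {n p r} {P : Fin n → Set p} (P? : Unary.Decidable P) {_⊏_ : Fin n → Fin n → Set r} →
          Decidable _⊏_ → (∀ i → ¬ (i ⊏ i)) → Transitive _⊏_ →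
          (∀ i → ¬ P i) ⊎ ∃[ i ] P i × (∀ j → P j → ¬ (i ⊏ j))
maximal {zero}  P? ⊏? irrefl tr = inj₁ λ ()
maximal {suc n} {P = P} P? {_⊏_} ⊏? irrefl tr
  with P? zero | maximal (P? ∘ suc) {λ i j → suc i ⊏ suc j} (λ i j → ⊏? (suc i) (suc j)) (irrefl ∘ suc) tr
... | no ¬p | inj₁ none          = inj₁ λ { zero → ¬p ; (suc i) → none i }
... | no ¬p | inj₂ (i , pi , mx) = inj₂ (suc i , pi , λ { zero p → contradiction p ¬p ; (suc j) → mx j })
... | yes p | inj₁ none          = inj₂ (zero , p , λ { zero _ → irrefl zero ; (suc j) pj → contradiction pj (none j) })
... | yes p | inj₂ (i , pi , mx) with ⊏? (suc i) zero
...   | yes i⊏0 = inj₂ (zero , p , λ { zero _ → irrefl zero ; (suc j) pj 0⊏j → mx j pj (tr i⊏0 0⊏j) })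
...   | no  i⊏̸0 = inj₂ (suc i , pi , λ { zero _ → i⊏̸0 ; (suc j) → mx j })

-- Polynomials over a finite field

funToFin-cong : ∀ {m n} {f g : Fin m → Fin n} → (∀ i → f i ≡ g i) → funToFin f ≡ funToFin g
funToFin-cong {zero}  f≗g = refl
funToFin-cong {suc m} f≗g = cong₂ combine (f≗g zero) (funToFin-cong (f≗g ∘ suc))

distinct⇒2≤ : ∀ {n} (i j : Fin n) → i ≢ j → 2 ≤ n
distinct⇒2≤ {suc zero}    zero zero i≢j = contradiction refl i≢j
distinct⇒2≤ {suc (suc n)} _    _    _   = s≤s (s≤s z≤n)

module _ {c ℓ} (F : Field c ℓ) where

  private module F = Field F

  *-≉0 : ∀ {a b} → a F.≉ F.0# → b F.≉ F.0# → a F.* b F.≉ F.0#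
  *-≉0 {a} {b} a≉0 b≉0 ab≈0 with F.invertible a≉0
  ... | a⁻¹ , a⁻¹a≈1 , _ = b≉0 (F.trans (F.sym (F.*-identityˡ b))
          (F.trans (F.*-congʳ (F.sym a⁻¹a≈1)) (F.trans (F.*-assoc a⁻¹ a b)
          (F.trans (F.*-congˡ ab≈0) (F.zeroʳ a⁻¹)))))

  module _ {k : ℕ} where

    open Polynomials F k

    sum-cong : ∀ {t u : Monomial k → F.Carrier} → (∀ β → t β F.≈ u β) →
               ∀ βs → sum (map t βs) F.≈ sum (map u βs)
    sum-cong t≈u []       = F.refl
    sum-cong t≈u (β ∷ βs) = F.+-cong (t≈u β) (sum-cong t≈u βs)

    sum-vanishing : ∀ (t : Monomial k → F.Carrier) βs → (∀ {β} → β ∈ βs → t β F.≈ F.0#) →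
                    sum (map t βs) F.≈ F.0#
    sum-vanishing t []       t≈0 = F.refl
    sum-vanishing t (β ∷ βs) t≈0 =
      F.trans (F.+-cong (t≈0 (here refl)) (sum-vanishing t βs (t≈0 ∘ there))) (F.+-identityˡ F.0#)

    sum-single : ∀ (t : Monomial k → F.Carrier) {α βs} → Unique βs → α ∈ βs →
                 (∀ {β} → β ∈ βs → β ≢ α → t β F.≈ F.0#) → sum (map t βs) F.≈ t α
    sum-single t {βs = β ∷ βs} (β∉ ∷ _) (here refl) t≈0 =
      F.trans (F.+-congˡ (sum-vanishing t βs
                (λ β′∈ → t≈0 (there β′∈) (λ β′≡β → All.lookup β∉ β′∈ (sym β′≡β)))))
              (F.+-identityʳ _)
    sum-single t {βs = β ∷ βs} (β∉ ∷ βs!) (there α∈) t≈0 =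
      F.trans (F.+-cong (t≈0 (here refl) (All.lookup β∉ α∈)) (sum-single t βs! α∈ (t≈0 ∘ there)))
              (F.+-identityˡ _)

    *ₚ-cong : ∀ {f f′ g g′} → f ≈ₚ f′ → g ≈ₚ g′ → f *ₚ g ≈ₚ f′ *ₚ g′
    *ₚ-cong f≈f′ g≈g′ α = sum-cong (λ β → F.*-cong (f≈f′ β) (g≈g′ (α ∸ₘ β))) (divisors α)

    VanishesAbove : ℕ → Polynomial → Set ℓ
    VanishesAbove m f = ∀ α → m < ∣ α ∣ → coeff f α F.≈ F.0#

    *ₚ-vanishesAbove : ∀ {m n} f g → VanishesAbove m f → VanishesAbove n g →
                       VanishesAbove (m + n) (f *ₚ g)
    -- The factors are rebuilt with the bounds m and n; the coefficients of a product do not depend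
    -- on the bounds.
    *ₚ-vanishesAbove f g f-van g-van = vanishes
      (record { coeff = coeff f ; vanishes = f-van } *ₚ record { coeff = coeff g ; vanishes = g-van })

    -- Several monomials may share the top degree, and their products may collide. A leading
    -- monomial singles out a coefficient of the product in which no cancellation can occur, so that
    -- degrees add.
    record Leading (f : Polynomial) (α : Monomial k) : Set ℓ where
      field
        nonzero  : coeff f α F.≉ F.0#
        greatest : ∀ β → α <ₘ β → coeff f β F.≈ F.0#
    open Leading

    leading-vanishesAbove : ∀ {f α} → Leading f α → VanishesAbove ∣ α ∣ f
    leading-vanishesAbove lead β lt = greatest lead β (inj₁ lt)

    leading-degree : ∀ {f α} → Leading f α → HasTotalDegree f ∣ α ∣
    leading-degree {f} {α} lead = (α , refl , nonzero lead) , leading-vanishesAbove {f} lead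

    degree-unique : ∀ {f m n} → HasTotalDegree f m → HasTotalDegree f n → m ≡ n
    degree-unique {f} {m} {n} ((α , refl , α≉0) , f-van) ((β , refl , β≉0) , f-van′) with <-cmp m n
    ... | tri< m<n _ _ = contradiction (f-van β m<n) β≉0
    ... | tri≈ _ m≡n _ = m≡n
    ... | tri> _ _ n<m = contradiction (f-van′ α n<m) α≉0

    degree-cong : ∀ {f g m} → f ≈ₚ g → HasTotalDegree f m → HasTotalDegree g m
    degree-cong f≈g ((α , ∣α∣≡m , α≉0) , f-van) =
      (α , ∣α∣≡m , λ e → α≉0 (F.trans (f≈g α) e)) , λ β lt → F.trans (F.sym (f≈g β)) (f-van β lt)

    -- By `<ₘ-+ₘ`, any other factorization of the monomial raises one factor above its leading
    -- monomial, so its term vanishes.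
    *ₚ-leading : ∀ {f g α β} → Leading f α → Leading g β →
                 coeff (f *ₚ g) (α +ₘ β) F.≈ coeff f α F.* coeff g β
    *ₚ-leading {f} {g} {α} {β} f-lead g-lead = F.trans
      (sum-single (λ β′ → coeff f β′ F.* coeff g ((α +ₘ β) ∸ₘ β′))
         (divisors-unique (α +ₘ β)) (∈-divisors α β) off)
      (F.reflexive (cong (λ γ → coeff f α F.* coeff g γ) (α+ₘβ∸ₘα≡β α β)))
      where
      off : ∀ {α′} → α′ ∈ divisors (α +ₘ β) → α′ ≢ α →
            coeff f α′ F.* coeff g ((α +ₘ β) ∸ₘ α′) F.≈ F.0#
      off {α′} α′∈ α′≢α with <ₘ-+ₘ α β α′ ((α +ₘ β) ∸ₘ α′) (divisor-complement (α +ₘ β) α′∈)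
      ... | inj₁ α′≡α        = contradiction α′≡α α′≢α
      ... | inj₂ (inj₁ α<α′) = F.trans (F.*-congʳ (greatest f-lead α′ α<α′)) (F.zeroˡ _)
      ... | inj₂ (inj₂ β<β′) = F.trans (F.*-congˡ (greatest g-lead _ β<β′)) (F.zeroʳ _)

    *ₚ-degree : ∀ {f g α β} → Leading f α → Leading g β → HasTotalDegree (f *ₚ g) (∣ α ∣ + ∣ β ∣)
    *ₚ-degree {f} {g} {α} {β} f-lead g-lead =
      (α +ₘ β , ∣∣-+ₘ α β ,
       λ e → *-≉0 (nonzero f-lead) (nonzero g-lead)
               (F.trans (F.sym (*ₚ-leading {f} {g} f-lead g-lead)) e)) ,
      *ₚ-vanishesAbove f g (leading-vanishesAbove {f} f-lead) (leading-vanishesAbove {g} g-lead)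

    *ₚ-zeroˡ : ∀ {f g} → f ≈ₚ 0ₚ → f *ₚ g ≈ₚ 0ₚ
    *ₚ-zeroˡ {f} {g} f≈0 α =
      sum-zero (λ β → coeff f β F.* coeff g (α ∸ₘ β)) (λ β → F.trans (F.*-congʳ (f≈0 β)) (F.zeroˡ _)) (divisors α)

    *ₚ-zeroʳ : ∀ {f g} → g ≈ₚ 0ₚ → f *ₚ g ≈ₚ 0ₚ
    *ₚ-zeroʳ {f} {g} g≈0 α =
      sum-zero (λ β → coeff f β F.* coeff g (α ∸ₘ β)) (λ β → F.trans (F.*-congˡ (g≈0 _)) (F.zeroʳ _)) (divisors α)

  module _ {q : ℕ} (size-F : HasSize F.setoid q) where

    private
      module I = Inverse size-F

    element : Fin q → F.Carrier
    element = I.to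

    index : F.Carrier → Fin q
    index = I.from

    element-index : ∀ a → element (index a) F.≈ a
    element-index a = I.inverseˡ refl

    index-element : ∀ i → index (element i) ≡ i
    index-element i = I.inverseʳ F.refl

    index-injective : ∀ {a b} → index a ≡ index b → a F.≈ b
    index-injective {a} {b} e =
      F.trans (F.sym (element-index a)) (F.trans (F.reflexive (cong element e)) (element-index b))

    infix 4 _≟F_
    _≟F_ : Decidable F._≈_
    a ≟F b = map′ index-injective I.from-cong (index a Fin.≟ index b)

    2≤size : 2 ≤ q
    2≤size = distinct⇒2≤ (index F.1#) (index F.0#) (F.1≉0 ∘ index-injective)

    module _ {k : ℕ} where

      open Polynomials F k
      open Leading

      -- The coefficients in degrees up to m serve as the base-q digits of a number, so polynomials
      -- can be searched and counted as elements of a `Fin`.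
      code : ∀ m → Polynomial → Fin (q ^ #monomials k m)
      code m f = funToFin (λ i → index (coeff f (monomialAt k m i)))

      decodeCoeff : ∀ m → Fin (q ^ #monomials k m) → (α : Monomial k) → Dec (∣ α ∣ ≤ m) → F.Carrier
      decodeCoeff m x α (yes p) = element (finToFun x (indexOf m α p))
      decodeCoeff m x α (no _)  = F.0#

      decode : ∀ m → Fin (q ^ #monomials k m) → Polynomial
      decode m x = record
        { coeff    = λ α → decodeCoeff m x α (∣ α ∣ ≤? m)
        ; bound    = m
        ; vanishes = vanish
        }
        where
        vanish : ∀ α → m < ∣ α ∣ → decodeCoeff m x α (∣ α ∣ ≤? m) F.≈ F.0#
        vanish α lt with ∣ α ∣ ≤? m
        ... | yes p = contradiction p (<⇒≱ lt)
        ... | no _  = F.refl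

      code-cong : ∀ m {f g} → f ≈ₚ g → code m f ≡ code m g
      code-cong m f≈g = funToFin-cong (λ i → I.from-cong (f≈g (monomialAt k m i)))

      decode-code : ∀ m {f} → VanishesAbove m f → decode m (code m f) ≈ₚ f
      decode-code m {f} f-van α with ∣ α ∣ ≤? m
      ... | yes p = F.trans
        (F.reflexive (cong element (trans (Fin.finToFun-funToFin (λ i → index (coeff f (monomialAt k m i))) (indexOf m α p))
           (cong (index ∘ coeff f) (monomialAt-indexOf m α p)))))
        (element-index (coeff f α))
      ... | no ≰ = F.sym (f-van α (≰⇒> ≰))

      code-injective : ∀ m {f g} → VanishesAbove m f → VanishesAbove m g → code m f ≡ code m g → f ≈ₚ g
      code-injective m {f} {g} f-van g-van e α =
        F.trans (F.sym (decode-code m {f} f-van α))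
          (F.trans (F.reflexive (cong (λ x → coeff (decode m x) α) e)) (decode-code m {g} g-van α))

      decode-injective : ∀ m {x y} → decode m x ≈ₚ decode m y → x ≡ y
      decode-injective m {x} {y} e =
        trans (sym (Fin.funToFin-finToFin {#monomials k m} x))
          (trans (funToFin-cong digit) (Fin.funToFin-finToFin {#monomials k m} y))
        where
        digit : ∀ i → finToFun x i ≡ finToFun y i
        digit i with ∣ monomialAt k m i ∣ ≤? m | e (monomialAt k m i)
        ... | no ≰  | _ = contradiction (∣monomialAt∣ k m i) ≰
        ... | yes p | eᵢ rewrite indexOf-monomialAt k m i p =
          trans (sym (index-element _)) (trans (I.from-cong eᵢ) (index-element _))

      vanishes-⊔ˡ : ∀ f n → VanishesAbove (bound f ⊔ n) f
      vanishes-⊔ˡ f n α lt = vanishes f α (≤-<-trans (m≤m⊔n (bound f) n) lt)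

      infix 4 _≟ₚ_
      -- Above the larger of the two bounds both polynomials vanish, so comparing finitely many
      -- coefficients is enough.
      _≟ₚ_ : Decidable _≈ₚ_
      f ≟ₚ g = map′
        (code-injective B {f} {g} (vanishes-⊔ˡ f (bound g))
           (λ α lt → vanishes g α (≤-<-trans (m≤n⊔m (bound f) (bound g)) lt)))
        (code-cong B {f} {g}) (code B f Fin.≟ code B g)
        where B = bound f ⊔ bound g

      infix 4 _∼?_
      _∼?_ : Decidable _∼_
      f ∼? g = map′
        (λ (i , ≉0 , e) → element i , ≉0 , e)
        (λ (a , a≉0 , e) → index a , (λ e₀ → a≉0 (F.trans (F.sym (element-index a)) e₀)) ,
           λ α → F.trans (e α) (F.*-congʳ (F.sym (element-index a))))
        (Fin.any? (λ i → ¬? (element i ≟F F.0#) ×-dec (f ≟ₚ element i · g)))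

      leading? : ∀ f → f ≈ₚ 0ₚ ⊎ ∃ (Leading f)
      leading? f with maximal (λ i → ¬? (coeff f (monomialAt k B i) ≟F F.0#))
                        {λ i j → monomialAt k B i <ₘ monomialAt k B j}
                        (λ i j → _ <ₗₑₓ? _) (λ i → <ₗₑₓ-irrefl _) (<ₗₑₓ-trans _ _ _)
        where B = bound f
      ... | inj₁ none = inj₁ λ α → zero-if (∣ α ∣ ≤? bound f)
        where
        zero-if : ∀ {α : Monomial k} → Dec (∣ α ∣ ≤ bound f) → coeff f α F.≈ F.0#
        zero-if {α} (no ≰)  = vanishes f α (≰⇒> ≰)
        zero-if {α} (yes p) = subst (λ β → coeff f β F.≈ F.0#) (monomialAt-indexOf (bound f) α p)
          (decidable-stable (_ ≟F _) (none (indexOf (bound f) α p)))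
      ... | inj₂ (i , i≉0 , mx) = inj₂ (monomialAt k (bound f) i , record
        { nonzero = i≉0 ; greatest = λ β lt → zero-if β (∣ β ∣ ≤? bound f) lt })
        where
        zero-if : ∀ β → Dec (∣ β ∣ ≤ bound f) → monomialAt k (bound f) i <ₘ β → coeff f β F.≈ F.0#
        zero-if β (no ≰)  _  = vanishes f β (≰⇒> ≰)
        zero-if β (yes p) lt = decidable-stable (_ ≟F _) λ β≉0 →
          mx (indexOf (bound f) β p)
             (subst (λ γ → coeff f γ F.≉ F.0#) (sym (monomialAt-indexOf (bound f) β p)) β≉0)
             (subst (monomialAt k (bound f) i <ₘ_) (sym (monomialAt-indexOf (bound f) β p)) lt)

      degree⇒leading : ∀ {f m} → HasTotalDegree f m → ∃[ α ] ∣ α ∣ ≡ m × Leading f α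
      degree⇒leading {f} deg@((β , _ , β≉0) , _) with leading? f
      ... | inj₁ f≈0        = contradiction (f≈0 β) β≉0
      ... | inj₂ (α , lead) = α , degree-unique {f = f} (leading-degree {f = f} lead) deg , lead

      degree? : ∀ f m → Dec (HasTotalDegree f m)
      degree? f m with leading? f
      ... | inj₁ f≈0 = no λ ((β , _ , β≉0) , _) → β≉0 (f≈0 β)
      ... | inj₂ (α , lead) = map′ (λ { refl → leading-degree {f = f} lead })
              (degree-unique {f = f} (leading-degree {f = f} lead)) (∣ α ∣ ≟ m)

      -- A product that has a degree is nonzero, hence so are its factors; these then have leading
      -- monomials, whose degrees add.
      *ₚ-degrees : ∀ {f h m} → HasTotalDegree (f *ₚ h) m →
                   ∃[ d ] ∃[ e ] HasTotalDegree h d × HasTotalDegree f e × e + d ≡ m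
      *ₚ-degrees {f} {h} deg@((β , _ , β≉0) , _) with leading? f | leading? h
      ... | inj₁ f≈0 | _ = contradiction (*ₚ-zeroˡ {f = f} {h} f≈0 β) β≉0
      ... | inj₂ _ | inj₁ h≈0 = contradiction (*ₚ-zeroʳ {f = f} {h} h≈0 β) β≉0
      ... | inj₂ (α , f-lead) | inj₂ (γ , h-lead) =
        ∣ γ ∣ , ∣ α ∣ , leading-degree {f = h} h-lead , leading-degree {f = f} f-lead ,
        degree-unique {f = f *ₚ h} (*ₚ-degree {f = f} {h} f-lead h-lead) deg

      -- The enumeration supplies some monomial of degree 0, and by `∣∣≡0` it can only be this one.
      ∣zero∣ : ∣ replicate k 0 ∣ ≡ 0
      ∣zero∣ = n≤0⇒n≡0 (subst (λ α → ∣ α ∣ ≤ 0) (∣∣≡0 α₀ (n≤0⇒n≡0 α₀≤0)) α₀≤0)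
        where
        α₀ = monomialAt k 0 (subst Fin (sym (#monomials-zero k)) zero)
        α₀≤0 = ∣monomialAt∣ k 0 (subst Fin (sym (#monomials-zero k)) zero)

      degree-1ₚ : HasTotalDegree 1ₚ 0
      degree-1ₚ =
        (replicate k 0 , ∣zero∣ , λ e → F.1≉0 (F.trans (F.sym (indicator-yes (replicate k 0 ≟ₘ replicate k 0) refl)) e)) ,
        λ α lt → indicator-no (α ≟ₘ replicate k 0) λ { refl → <⇒≢ lt (sym ∣zero∣) }

      -- `h` is a nonzero constant, and the cofactor is its inverse as a constant polynomial. The
      -- only coefficient at stake is the one at the product of the leading monomials, so
      -- `*ₚ-leading` computes it.
      degree-zero⇒∣1ₚ : ∀ {h} → HasTotalDegree h 0 → h ∣ 1ₚ
      degree-zero⇒∣1ₚ {h} h-deg with degree⇒leading {f = h} h-deg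
      ... | α , ∣α∣≡0 , h-lead with F.invertible (nonzero h-lead)
      ...   | a , a*h≈1 , h*a≈1 = record { quotient = u ; equality = u*h≈1 }
        where
        z = replicate k 0

        u : Polynomial
        u = a · 1ₚ

        1-at-z : coeff 1ₚ z F.≈ F.1#
        1-at-z = indicator-yes (z ≟ₘ z) refl

        u-at-z : coeff u z F.≈ a
        u-at-z = F.trans (F.*-congˡ 1-at-z) (F.*-identityʳ a)

        u-deg : HasTotalDegree u 0
        u-deg = (z , ∣zero∣ , λ e → F.1≉0 (F.trans (F.sym a*h≈1)
                  (F.trans (F.*-congʳ (F.trans (F.sym u-at-z) e)) (F.zeroˡ _)))) ,
                λ β lt → F.trans (F.*-congˡ (proj₂ degree-1ₚ β lt)) (F.zeroʳ a)

        u*h-vanishes : VanishesAbove 0 (u *ₚ h)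
        u*h-vanishes = *ₚ-vanishesAbove u h (proj₂ u-deg) (proj₂ h-deg)

        at-zero : coeff (u *ₚ h) z F.≈ F.1#
        at-zero with degree⇒leading {f = u} u-deg
        ... | β , ∣β∣≡0 , u-lead = F.trans
          (F.reflexive (cong (coeff (u *ₚ h)) (sym (∣∣≡0 (β +ₘ α) (trans (∣∣-+ₘ β α) (cong₂ _+_ ∣β∣≡0 ∣α∣≡0))))))
          (F.trans (*ₚ-leading {f = u} {h} u-lead h-lead)
          (F.trans (F.*-congʳ (F.trans (F.reflexive (cong (coeff u) (∣∣≡0 β ∣β∣≡0))) u-at-z)) a*h≈1))

        u*h≈1 : u *ₚ h ≈ₚ 1ₚ
        u*h≈1 β with ∣ β ∣ ≟ 0
        ... | no ≢0 = F.trans (u*h-vanishes β (n≢0⇒n>0 ≢0)) (F.sym (proj₂ degree-1ₚ β (n≢0⇒n>0 ≢0)))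
        ... | yes ≡0 = subst (λ γ → coeff (u *ₚ h) γ F.≈ coeff 1ₚ γ) (sym (∣∣≡0 β ≡0)) (F.trans at-zero (F.sym 1-at-z))

-- Coprime pairs and common factors

module _ {a ℓ} (S : Setoid a ℓ) where

  open Setoid S using (_≈_) renaming (Carrier to A; sym to ≈-sym; trans to ≈-trans)
  open UniqueSetoid S using () renaming (Unique to Uniqueₛ)
  open Enumerates S using (IsEnumeration)

  lookup-injective : ∀ {xs} → Uniqueₛ xs → ∀ {i j} → lookup xs i ≈ lookup xs j → i ≡ j
  lookup-injective (_   ∷ _)   {zero}  {zero}  _ = refl
  lookup-injective (x≉ ∷ _)   {zero}  {suc j} e = contradiction e (All.lookup x≉ (∈-lookup j))
  lookup-injective (x≉ ∷ _)   {suc i} {zero}  e = contradiction (≈-sym e) (All.lookup x≉ (∈-lookup i))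
  lookup-injective (_   ∷ xs!) {suc i} {suc j} e = cong suc (lookup-injective xs! e)

  enumeration⇒finite : Decidable _≈_ → ∀ {xs} → IsEnumeration xs → Finite S
  enumeration⇒finite _≈?_ {xs} enum = _ , record
    { to        = lookup ys
    ; from      = from
    ; to-cong   = λ { refl → Setoid.refl S }
    ; from-cong = λ {x} {y} x≈y → inj (≈-trans (≈-sym (at x)) (≈-trans x≈y (at y)))
    ; inverse   = (λ { {x} refl → ≈-sym (at x) }) , (λ {i} {x} x≈ → inj (≈-trans (≈-sym (at x)) x≈))
    }
    where
    DS : DecSetoid a ℓ
    DS = record { isDecEquivalence = record { isEquivalence = Setoid.isEquivalence S ; _≟_ = _≈?_ } }

    ys = deduplicate _≈?_ xs

    ys-enum : IsEnumeration ys
    ys-enum = deduplicate⁺ DS enum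

    from : A → Fin (List.length ys)
    from x = Any.index (ys-enum x)

    at : ∀ x → x ≈ lookup ys (from x)
    at x = lookup-index (ys-enum x)

    inj : ∀ {i j} → lookup ys i ≈ lookup ys j → i ≡ j
    inj = lookup-injective (deduplicate-! DS xs)

  private
    collect : ∀ {n r} {R : Fin n → A → Set r} → (∀ i → Dec (∃ (R i))) → List A
    collect {zero}  R? = []
    collect {suc n} R? with R? zero
    ... | yes (x , _) = x ∷ collect (R? ∘ suc)
    ... | no  _       = collect (R? ∘ suc)

    collect⁺ : ∀ {n r} {R : Fin n → A → Set r} (R? : ∀ i → Dec (∃ (R i))) →
               (∀ {i x y} → R i x → R i y → x ≈ y) →
               ∀ {i x} → R i x → Any (x ≈_) (collect R?)
    collect⁺ {suc n} R? fun {i} r with R? zero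
    collect⁺ {suc n} R? fun {zero}  r | yes (_ , r′) = here (fun r r′)
    collect⁺ {suc n} R? fun {suc i} r | yes _        = there (collect⁺ (R? ∘ suc) fun r)
    collect⁺ {suc n} R? fun {zero}  r | no  ¬r       = contradiction (_ , r) ¬r
    collect⁺ {suc n} R? fun {suc i} r | no  _        = collect⁺ (R? ∘ suc) fun r

  -- A code may stand for no element, and equivalent elements may have different codes. One element
  -- is kept for each inhabited code, and the decidable equivalence then removes repetitions.
  coded⇒finite : ∀ {n r} {R : Fin n → A → Set r} → Decidable _≈_ → (∀ i → Dec (∃ (R i))) →
                 (∀ {i x y} → R i x → R i y → x ≈ y) → (∀ x → ∃[ i ] R i x) → Finite S
  coded⇒finite ≈? R? fun total = enumeration⇒finite ≈? {collect R?} λ x → collect⁺ R? fun (proj₂ (total x))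

HasSize-to-injective : ∀ {a ℓ} {S : Setoid a ℓ} {n} (h : HasSize S n) → ∀ {i j} →
                       Setoid._≈_ S (Inverse.to h i) (Inverse.to h j) → i ≡ j
HasSize-to-injective {S = S} h {i} {j} e =
  trans (sym (Inverse.inverseʳ h (Setoid.refl S))) (Inverse.inverseʳ h e)

HasSize-from-injective : ∀ {a ℓ} {S : Setoid a ℓ} {n} (h : HasSize S n) → ∀ {x y} →
                         Inverse.from h x ≡ Inverse.from h y → Setoid._≈_ S x y
HasSize-from-injective {S = S} h e =
  Setoid.trans S (Setoid.sym S (Inverse.inverseˡ h refl)) (Inverse.inverseˡ h e)

remQuot-injective : ∀ {m} n {i j : Fin (m * n)} → remQuot {m} n i ≡ remQuot n j → i ≡ j
remQuot-injective {m} n {i} {j} e =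
  trans (sym (Fin.combine-remQuot {m} n i)) (trans (cong (λ (a , b) → combine a b) e) (Fin.combine-remQuot {m} n j))

join-injective : ∀ m n {x y : Fin m ⊎ Fin n} → join m n x ≡ join m n y → x ≡ y
join-injective m n {x} {y} e =
  trans (sym (Fin.splitAt-join m n x)) (trans (cong (Fin.splitAt m) e) (Fin.splitAt-join m n y))

module _ {c ℓ} (F : Field c ℓ) {q : ℕ} (size-F : HasSize (Field.setoid F) q) {k : ℕ} where

  private
    module F = Field F

  open Polynomials F k

  private
    instance
      q-nonZero : NonZero q
      q-nonZero = >-nonZero (≤-trans (s≤s z≤n) (2≤size F size-F))

    Code : ℕ → Set
    Code m = Fin (q ^ #monomials k m)

    ⟦_⟧ : ∀ {m} → Code m → Polynomial
    ⟦_⟧ {m} = decode F size-F m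

    encode : ∀ m → Polynomial → Code m
    encode = code F size-F

    ⟦encode⟧ : ∀ {m} f → HasTotalDegree f m → ⟦ encode m f ⟧ ≈ₚ f
    ⟦encode⟧ {m} f deg = decode-code F size-F m {f} (proj₂ deg)

    deg? : ∀ f m → Dec (HasTotalDegree f m)
    deg? = degree? F size-F

    ≈ₚ-trans : ∀ {f g h} → f ≈ₚ g → g ≈ₚ h → f ≈ₚ h
    ≈ₚ-trans f≈g g≈h α = F.trans (f≈g α) (g≈h α)

    ≈ₚ-sym : ∀ {f g} → f ≈ₚ g → g ≈ₚ f
    ≈ₚ-sym f≈g α = F.sym (f≈g α)

    ≈ₚ⇒∼ : ∀ {f g} → f ≈ₚ g → f ∼ g
    ≈ₚ⇒∼ f≈g = F.1# , F.1≉0 , λ α → F.trans (f≈g α) (F.sym (F.*-identityˡ _))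

  finite-𝒩 : ∀ m → Finite (𝒩 m)
  finite-𝒩 m = coded⇒finite (𝒩 m) {R = λ x (f , _) → ⟦ x ⟧ ≈ₚ f}
    (λ (f , _) (g , _) → _∼?_ F size-F f g)
    (λ x → map′ (λ d → (⟦ x ⟧ , d) , λ _ → F.refl)
                (λ ((f , d) , e) → degree-cong F {f = f} {g = ⟦ x ⟧} (≈ₚ-sym {⟦ x ⟧} {f} e) d)
                (deg? ⟦ x ⟧ m))
    (λ {x} {(f , _)} {(g , _)} e e′ → ≈ₚ⇒∼ {f} {g} (≈ₚ-trans {f} {⟦ x ⟧} {g} (≈ₚ-sym {⟦ x ⟧} {f} e) e′))
    (λ (f , d) → encode m f , ⟦encode⟧ f d)

  -- A common divisor of positive degree d ≤ s of polynomials of degrees m and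
  -- n, with its cofactors, all given by codes so that they can be searched for
  -- and counted.
  record CommonFactor (s m n : ℕ) (f g : Polynomial) : Set ℓ where
    constructor commonFactor
    field
      {d-1} : Fin s

    d : ℕ
    d = suc (toℕ d-1)

    field
      {d≤m} : d ≤ m
      {d≤n} : d ≤ n
      h   : Code d
      u   : Code (m ∸ d)
      v   : Code (n ∸ d)
      h-degree : HasTotalDegree ⟦ h ⟧ d
      u*h≈f : ⟦ u ⟧ *ₚ ⟦ h ⟧ ≈ₚ f
      v*h≈g : ⟦ v ⟧ *ₚ ⟦ h ⟧ ≈ₚ g

  commonFactor? : ∀ s m n f g → Dec (CommonFactor s m n f g)
  commonFactor? s m n f g = map′
    (λ (i , d≤m , d≤n , h , u , v , h-deg , e , e′) → record
      { d-1 = i ; d≤m = d≤m ; d≤n = d≤n ; h = h ; u = u ; v = v ; h-degree = h-deg ; u*h≈f = e ; v*h≈g = e′ })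
    (λ cf → let open CommonFactor cf in d-1 , d≤m , d≤n , h , u , v , h-degree , u*h≈f , v*h≈g)
    (Fin.any? λ i → suc (toℕ i) ≤? m ×-dec suc (toℕ i) ≤? n ×-dec
      Fin.any? λ h → Fin.any? λ u → Fin.any? λ v →
        deg? ⟦ h ⟧ (suc (toℕ i)) ×-dec _≟ₚ_ F size-F (⟦ u ⟧ *ₚ ⟦ h ⟧) f ×-dec _≟ₚ_ F size-F (⟦ v ⟧ *ₚ ⟦ h ⟧) g)

  -- Coprimality would make `h` a divisor of `1ₚ`, so its degree would be 0, but that degree is a
  -- successor.
  commonFactor⇒¬coprime : ∀ {s m n f g} → CommonFactor s m n f g → ¬ Coprime f g
  commonFactor⇒¬coprime cf cop with cop {⟦ h ⟧}
    (record { quotient = ⟦ u ⟧ ; equality = u*h≈f })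
    (record { quotient = ⟦ v ⟧ ; equality = v*h≈g })
    where open CommonFactor cf
  ... | record { quotient = w ; equality = e }
    with d′ , e′ , h-deg , _ , sum≡0 ← *ₚ-degrees F size-F {f = w} {h = ⟦ CommonFactor.h cf ⟧}
           (degree-cong F {f = 1ₚ} {g = w *ₚ ⟦ CommonFactor.h cf ⟧}
             (≈ₚ-sym {w *ₚ ⟦ CommonFactor.h cf ⟧} {1ₚ} e) (degree-1ₚ F size-F))
    with () ← trans (degree-unique F {f = ⟦ CommonFactor.h cf ⟧} (CommonFactor.h-degree cf) h-deg)
                    (m+n≡0⇒n≡0 e′ sum≡0)

  cofactor-degree : ∀ {m f z} → HasTotalDegree f m → (z∣f : z ∣ f) →
                    ∃[ d ] HasTotalDegree z d × d ≤ m × HasTotalDegree (_∣ʳ_.quotient z∣f) (m ∸ d)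
  cofactor-degree {m} {f} {z} f-deg record { quotient = w ; equality = e }
    with d , d′ , z-deg , w-deg , refl ← *ₚ-degrees F size-F {f = w} {h = z}
           (degree-cong F {f = f} {g = w *ₚ z} (≈ₚ-sym {w *ₚ z} {f} e) f-deg) =
    d , z-deg , m≤n+m d d′ , subst (HasTotalDegree w) (sym (m+n∸n≡m d′ d)) w-deg

  -- A common divisor has a degree at most m ⊓ n, hence at most `s`. In degree 0 it is a constant
  -- and divides `1ₚ`; in positive degree its code and those of its cofactors would form an excluded
  -- `CommonFactor`.
  ¬commonFactor⇒coprime : ∀ {s m n f g} → m ⊓ n ≤ s → HasTotalDegree f m → HasTotalDegree g n →
                          ¬ CommonFactor s m n f g → Coprime f g
  ¬commonFactor⇒coprime {s} {m} {n} {f} {g} m⊓n≤s f-deg g-deg none {z} z∣f z∣g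
    with d , z-deg , d≤m , u-deg ← cofactor-degree {f = f} {z} f-deg z∣f
       | d′ , z-deg′ , d′≤n , v-deg ← cofactor-degree {f = g} {z} g-deg z∣g
    with refl ← degree-unique F {f = z} z-deg z-deg′ = go d z-deg d≤m d′≤n u-deg v-deg
    where
    u = _∣ʳ_.quotient z∣f
    v = _∣ʳ_.quotient z∣g

    fin : ∀ {i} → i < s → ∃[ j ] i ≡ toℕ {s} j
    fin i<s = fromℕ< i<s , sym (Fin.toℕ-fromℕ< i<s)

    go : ∀ d → HasTotalDegree z d → d ≤ m → d ≤ n →
         HasTotalDegree u (m ∸ d) → HasTotalDegree v (n ∸ d) → z ∣ 1ₚ
    go zero z-deg _ _ _ _ = degree-zero⇒∣1ₚ F size-F z-deg
    go (suc i) z-deg d≤m d≤n u-deg v-deg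
      with j , refl ← fin (≤-trans (⊓-glb d≤m d≤n) m⊓n≤s) = contradiction (record
      { d-1 = j ; d≤m = d≤m ; d≤n = d≤n
      ; h = encode (suc i) z ; u = encode (m ∸ suc i) u ; v = encode (n ∸ suc i) v
      ; h-degree = degree-cong F {f = z} {g = ⟦ encode (suc i) z ⟧}
          (≈ₚ-sym {⟦ encode (suc i) z ⟧} {z} (⟦encode⟧ z z-deg)) z-deg
      ; u*h≈f = ≈ₚ-trans {⟦ encode _ u ⟧ *ₚ ⟦ encode _ z ⟧} {u *ₚ z} {f}
          (*ₚ-cong F {f = ⟦ encode _ u ⟧} {u} {⟦ encode _ z ⟧} {z} (⟦encode⟧ u u-deg) (⟦encode⟧ z z-deg)) (_∣ʳ_.equality z∣f)
      ; v*h≈g = ≈ₚ-trans {⟦ encode _ v ⟧ *ₚ ⟦ encode _ z ⟧} {v *ₚ z} {g}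
          (*ₚ-cong F {f = ⟦ encode _ v ⟧} {v} {⟦ encode _ z ⟧} {z} (⟦encode⟧ v v-deg) (⟦encode⟧ z z-deg)) (_∣ʳ_.equality z∣g)
      }) none

  commonFactor⊎coprime : ∀ {s m n f g} → m ⊓ n ≤ s → HasTotalDegree f m → HasTotalDegree g n →
                         CommonFactor s m n f g ⊎ Coprime f g
  commonFactor⊎coprime {s} {m} {n} {f} {g} m⊓n≤s f-deg g-deg with commonFactor? s m n f g
  ... | yes cf  = inj₁ cf
  ... | no  ¬cf = inj₂ λ {z} → ¬commonFactor⇒coprime m⊓n≤s f-deg g-deg ¬cf {z}

  coprime? : ∀ {m n f g} → HasTotalDegree f m → HasTotalDegree g n → Dec (Coprime f g)
  coprime? {m} {n} {f} {g} f-deg g-deg with commonFactor⊎coprime (m⊓n≤m m n) f-deg g-deg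
  ... | inj₁ cf  = no (commonFactor⇒¬coprime cf)
  ... | inj₂ cop = yes λ {z} → cop {z}

  coprime-cong : ∀ {f f′ g g′} → f ≈ₚ f′ → g ≈ₚ g′ → Coprime f g → Coprime f′ g′
  coprime-cong {f} {f′} {g} {g′} f≈f′ g≈g′ cop {z} z∣f′ z∣g′ = cop {z}
    (record { quotient = u ; equality = ≈ₚ-trans {u *ₚ z} {f′} {f} (_∣ʳ_.equality z∣f′) (≈ₚ-sym {f} {f′} f≈f′) })
    (record { quotient = v ; equality = ≈ₚ-trans {v *ₚ z} {g′} {g} (_∣ʳ_.equality z∣g′) (≈ₚ-sym {g} {g′} g≈g′) })
    where
    u = _∣ʳ_.quotient z∣f′
    v = _∣ʳ_.quotient z∣g′

  finite-𝒫 : ∀ m n → Finite (𝒫 m n)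
  finite-𝒫 m n = coded⇒finite (𝒫 m n)
    {n = q ^ #monomials k m * q ^ #monomials k n}
    {R = λ x (((f , _) , (g , _)) , _) → ⟦ left x ⟧ ≈ₚ f × ⟦ right x ⟧ ≈ₚ g}
    (λ (((f , _) , (g , _)) , _) (((f′ , _) , (g′ , _)) , _) → _∼?_ F size-F f f′ ×-dec _∼?_ F size-F g g′)
    pair?
    (λ {x} {(((f , _) , (g , _)) , _)} {(((f′ , _) , (g′ , _)) , _)} (e₁ , e₂) (e₁′ , e₂′) →
      ≈ₚ⇒∼ {f} {f′} (≈ₚ-trans {f} {⟦ left x ⟧} {f′} (≈ₚ-sym {⟦ left x ⟧} {f} e₁) e₁′) ,
      ≈ₚ⇒∼ {g} {g′} (≈ₚ-trans {g} {⟦ right x ⟧} {g′} (≈ₚ-sym {⟦ right x ⟧} {g} e₂) e₂′))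
    (λ (((f , f-deg) , (g , g-deg)) , _) → combine (encode m f) (encode n g) ,
      subst (λ (x , y) → ⟦ x ⟧ ≈ₚ f × ⟦ y ⟧ ≈ₚ g) (sym (Fin.remQuot-combine (encode m f) (encode n g)))
        (⟦encode⟧ f f-deg , ⟦encode⟧ g g-deg))
    where
    left : Fin (q ^ #monomials k m * q ^ #monomials k n) → Code m
    left = proj₁ ∘ remQuot {q ^ #monomials k m} (q ^ #monomials k n)

    right : Fin (q ^ #monomials k m * q ^ #monomials k n) → Code n
    right = proj₂ ∘ remQuot {q ^ #monomials k m} (q ^ #monomials k n)

    pair? : ∀ x → Dec (Σ[ (((f , _) , (g , _)) , _) ∈ Setoid.Carrier (𝒫 m n) ]
                         (⟦ left x ⟧ ≈ₚ f × ⟦ right x ⟧ ≈ₚ g))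
    pair? x with deg? ⟦ left x ⟧ m | deg? ⟦ right x ⟧ n
    ... | no ¬d | _ = no λ ((((f , f-deg) , _) , _) , e , _) →
            ¬d (degree-cong F {f = f} {g = ⟦ left x ⟧} (≈ₚ-sym {⟦ left x ⟧} {f} e) f-deg)
    ... | yes _ | no ¬d = no λ (((_ , (g , g-deg)) , _) , _ , e) →
            ¬d (degree-cong F {f = g} {g = ⟦ right x ⟧} (≈ₚ-sym {⟦ right x ⟧} {g} e) g-deg)
    ... | yes d₁ | yes d₂ with coprime? d₁ d₂
    ...   | yes cop = yes ((((_ , d₁) , (_ , d₂)) , λ {z} → cop {z}) , (λ _ → F.refl) , (λ _ → F.refl))
    ...   | no ¬cop = no λ ((((f , _) , (g , _)) , cop) , e₁ , e₂) →
              ¬cop (λ {z} → coprime-cong {f} {⟦ left x ⟧} {g} {⟦ right x ⟧}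
                (≈ₚ-sym {⟦ left x ⟧} {f} e₁) (≈ₚ-sym {⟦ right x ⟧} {g} e₂) (λ {z} → cop {z}) {z})

  -- Bounds for the numbers of classes

  module _ (finite-𝒩 : ∀ m → Finite (𝒩 m)) (finite-𝒫 : ∀ m n → Finite (𝒫 m n)) where

    private
      N : ℕ → ℕ
      N m = size {S = 𝒩 m} (finite-𝒩 m)

      P : ℕ → ℕ → ℕ
      P m n = size {S = 𝒫 m n} (finite-𝒫 m n)

    private
      classOf : ∀ {m} → Setoid.Carrier (𝒩 m) → Fin (N m)
      classOf {m} = Inverse.from (proj₂ (finite-𝒩 m))

      representative : ∀ {m} → Fin (N m) → Setoid.Carrier (𝒩 m)
      representative {m} = Inverse.to (proj₂ (finite-𝒩 m))

    P≤N*N : ∀ m n → P m n ≤ N m * N n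
    P≤N*N m n = Fin.injective⇒≤ {f = classes} λ {x} {y} e →
      let e₁ , e₂ = Fin.combine-injective (classOf (proj₁ (pair x))) _ (classOf (proj₁ (pair y))) _ e in
      HasSize-to-injective {S = 𝒫 m n} (proj₂ (finite-𝒫 m n))
        (HasSize-from-injective {S = 𝒩 m} (proj₂ (finite-𝒩 m)) e₁ ,
         HasSize-from-injective {S = 𝒩 n} (proj₂ (finite-𝒩 n)) e₂)
      where
      pair : Fin (P m n) → Setoid.Carrier (𝒩 m ×ₛ 𝒩 n)
      pair = proj₁ ∘ Inverse.to (proj₂ (finite-𝒫 m n))

      classes : Fin (P m n) → Fin (N m * N n)
      classes x = combine (classOf (proj₁ (pair x))) (classOf (proj₂ (pair x)))

    -- A polynomial of degree at most m is determined by its coefficient at a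
    -- fixed monomial μ of degree m and by the class of the polynomial obtained by
    -- resetting this coefficient to 1.
    q^#monomials≤q*N : 1 ≤ k → ∀ m → q ^ #monomials k m ≤ q * N m
    q^#monomials≤q*N 1≤k m with (_ , (μ , ∣μ∣≡m , _) , _) ← 𝒩-inhabited F 1≤k m =
      Fin.injective⇒≤ {f = λ x → combine (index F size-F (coeff ⟦ x ⟧ μ)) (classOf (monic x))} injective
      where
      monicCoeff : Code m → (α : Monomial k) → Dec (α ≡ μ) → F.Carrier
      monicCoeff x α (yes _) = F.1#
      monicCoeff x α (no _)  = coeff ⟦ x ⟧ α

      monicCoeff-μ : ∀ x α? → monicCoeff x μ α? F.≈ F.1#
      monicCoeff-μ x (yes _)  = F.refl
      monicCoeff-μ x (no μ≢μ) = contradiction refl μ≢μ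

      monicCoeff-vanishes : ∀ x α α? → m < ∣ α ∣ → monicCoeff x α α? F.≈ F.0#
      monicCoeff-vanishes x α (yes refl) lt = contradiction (sym ∣μ∣≡m) (<⇒≢ lt)
      monicCoeff-vanishes x α (no _)     lt = vanishes ⟦ x ⟧ α lt

      monic : Code m → Setoid.Carrier (𝒩 m)
      monic x =
        record { coeff = λ α → monicCoeff x α (α ≟ₘ μ) ; vanishes = λ α → monicCoeff-vanishes x α (α ≟ₘ μ) } ,
        (μ , ∣μ∣≡m , λ e → F.1≉0 (F.trans (F.sym (monicCoeff-μ x (μ ≟ₘ μ))) e)) ,
        λ α → monicCoeff-vanishes x α (α ≟ₘ μ)

      injective : ∀ {x y} → combine (index F size-F (coeff ⟦ x ⟧ μ)) (classOf (monic x)) ≡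
                            combine (index F size-F (coeff ⟦ y ⟧ μ)) (classOf (monic y)) → x ≡ y
      injective {x} {y} e
        with e₁ , e₂ ← Fin.combine-injective (index F size-F (coeff ⟦ x ⟧ μ)) _ (index F size-F (coeff ⟦ y ⟧ μ)) _ e
        with a , _ , x∼y ← HasSize-from-injective {S = 𝒩 m} (proj₂ (finite-𝒩 m)) {monic x} {monic y} e₂ =
        decode-injective F size-F m λ α → coeff-≈ α (α ≟ₘ μ) (x∼y α)
        where
        -- Both normalized polynomials have coefficient 1 at `μ`, which forces the scalar relating
        -- them to be 1.
        a≈1 : a F.≈ F.1#
        a≈1 = F.trans (F.sym (F.*-identityʳ a)) (F.trans (F.*-congˡ (F.sym (monicCoeff-μ y (μ ≟ₘ μ))))
                (F.trans (F.sym (x∼y μ)) (monicCoeff-μ x (μ ≟ₘ μ))))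

        coeff-≈ : ∀ α α? → monicCoeff x α α? F.≈ a F.* monicCoeff y α α? → coeff ⟦ x ⟧ α F.≈ coeff ⟦ y ⟧ α
        coeff-≈ α (yes refl) _  = index-injective F size-F e₁
        coeff-≈ α (no _)     eq = F.trans eq (F.trans (F.*-congʳ a≈1) (F.*-identityˡ _))

    module _ {s m n E} (m⊓n≤s : m ⊓ n ≤ s)
      (#≤E : ∀ d → 1 ≤ d → d ≤ m → d ≤ n → #monomials k d + (#monomials k (m ∸ d) + #monomials k (n ∸ d)) ≤ E) where

      private
        codes≤ : ∀ d → 1 ≤ d → d ≤ m → d ≤ n →
                 q ^ #monomials k d * (q ^ #monomials k (m ∸ d) * q ^ #monomials k (n ∸ d)) ≤ q ^ E
        codes≤ d 1≤d d≤m d≤n = begin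
          q ^ #monomials k d * (q ^ #monomials k (m ∸ d) * q ^ #monomials k (n ∸ d))
            ≡⟨ cong (q ^ #monomials k d *_) (^-distribˡ-+-* q (#monomials k (m ∸ d)) (#monomials k (n ∸ d))) ⟨
          q ^ #monomials k d * q ^ (#monomials k (m ∸ d) + #monomials k (n ∸ d))
            ≡⟨ ^-distribˡ-+-* q (#monomials k d) _ ⟨
          q ^ (#monomials k d + (#monomials k (m ∸ d) + #monomials k (n ∸ d)))
            ≤⟨ ^-monoʳ-≤ q (#≤E d 1≤d d≤m d≤n) ⟩
          q ^ E ∎
          where open ≤-Reasoning

        -- The factor `s` records the degree of the common factor. For each degree the triple of
        -- codes is embedded in a block of the common size q ^ E.
        factorCode : ∀ {f g} → CommonFactor s m n f g → Fin (s * q ^ E)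
        factorCode (commonFactor {i} {d≤m} {d≤n} h u v _ _ _) =
          combine i (inject≤ (combine h (combine u v)) (codes≤ (suc (toℕ i)) (s≤s z≤n) d≤m d≤n))

        -- The block gives the degree, the position in it gives the codes of h, u and v, and these
        -- determine f = u h and g = v h.
        factorCode-injective : ∀ {f g f′ g′} (cf : CommonFactor s m n f g) (cf′ : CommonFactor s m n f′ g′) →
                               factorCode cf ≡ factorCode cf′ → f ≈ₚ f′ × g ≈ₚ g′
        factorCode-injective {f} {g} {f′} {g′}
          (commonFactor {i} {d≤m} {d≤n} h u v _ e₁ e₂)
          (commonFactor {i′} {d≤m′} {d≤n′} h′ u′ v′ _ e₁′ e₂′) eq
          with refl , eq′ ← Fin.combine-injective i _ i′ _ eq
          with refl , eq″ ← Fin.combine-injective h _ h′ _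
                 (Fin.inject≤-injective (codes≤ (suc (toℕ i)) (s≤s z≤n) d≤m d≤n)
                                       (codes≤ (suc (toℕ i)) (s≤s z≤n) d≤m′ d≤n′) _ _ eq′)
          with refl , refl ← Fin.combine-injective u v u′ v′ eq″ =
          ≈ₚ-trans {f} {⟦ u ⟧ *ₚ ⟦ h ⟧} {f′} (≈ₚ-sym {⟦ u ⟧ *ₚ ⟦ h ⟧} {f} e₁) e₁′ ,
          ≈ₚ-trans {g} {⟦ v ⟧ *ₚ ⟦ h ⟧} {g′} (≈ₚ-sym {⟦ v ⟧ *ₚ ⟦ h ⟧} {g} e₂) e₂′

        Pair : Set _
        Pair = Setoid.Carrier (𝒩 m ×ₛ 𝒩 n)

        Split : Pair → Set _
        Split ((f , _) , (g , _)) = CommonFactor s m n f g ⊎ Coprime f g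

        pairCode : ∀ p → Split p → Fin (P m n) ⊎ Fin (s * q ^ E)
        pairCode p (inj₁ cf)  = inj₂ (factorCode cf)
        pairCode p (inj₂ cop) = inj₁ (Inverse.from (proj₂ (finite-𝒫 m n)) (p , λ {z} → cop {z}))

        pairCode-injective : ∀ p p′ x x′ → pairCode p x ≡ pairCode p′ x′ → Setoid._≈_ (𝒩 m ×ₛ 𝒩 n) p p′
        pairCode-injective ((f , _) , (g , _)) ((f′ , _) , (g′ , _)) (inj₁ cf) (inj₁ cf′) e
          with e₁ , e₂ ← factorCode-injective cf cf′ (inj₂-injective e) = ≈ₚ⇒∼ {f} {f′} e₁ , ≈ₚ⇒∼ {g} {g′} e₂
        pairCode-injective p p′ (inj₂ cop) (inj₂ cop′) e =
          HasSize-from-injective {S = 𝒫 m n} (proj₂ (finite-𝒫 m n))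
            {p , λ {z} → cop {z}} {p′ , λ {z} → cop′ {z}} (inj₁-injective e)

        representatives : Fin (N m * N n) → Pair
        representatives x = representative (proj₁ (remQuot {N m} (N n) x)) , representative (proj₂ (remQuot {N m} (N n) x))

        splitting : ∀ p → Split p
        splitting ((f , f-deg) , (g , g-deg)) = commonFactor⊎coprime {f = f} {g} m⊓n≤s f-deg g-deg

      -- Each pair of classes is sent, through its chosen representatives, to its class in `𝒫` if
      -- they are coprime and to the code of a common factor otherwise. In either case the image
      -- determines the pair of classes.
      N*N≤P+factors : N m * N n ≤ P m n + s * q ^ E
      N*N≤P+factors = Fin.injective⇒≤
        {f = join (P m n) (s * q ^ E) ∘ pairOrFactor}
        λ {x} {y} e →
          let e₁ , e₂ = pairCode-injective (representatives x) (representatives y)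
                          (splitting (representatives x)) (splitting (representatives y))
                          (join-injective (P m n) (s * q ^ E) {pairOrFactor x} {pairOrFactor y} e) in
          remQuot-injective {N m} (N n) (cong₂ _,_
            (HasSize-to-injective {S = 𝒩 m} (proj₂ (finite-𝒩 m)) e₁)
            (HasSize-to-injective {S = 𝒩 n} (proj₂ (finite-𝒩 n)) e₂))
        where
        pairOrFactor : Fin (N m * N n) → Fin (P m n) ⊎ Fin (s * q ^ E)
        pairOrFactor x = pairCode (representatives x) (splitting (representatives x))

-- Passage to the limit

module _ {c ℓ} (F : Field c ℓ) {q : ℕ} (size-F : HasSize (Field.setoid F) q) {k : ℕ} (2≤k : 2 ≤ k)
  (finite-𝒩 : ∀ m → Finite (Polynomials.𝒩 F k m)) (finite-𝒫 : ∀ m n → Finite (Polynomials.𝒫 F k m n)) where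

  open Density F 2≤k finite-𝒩 finite-𝒫

  private
    D : ℕ → ℕ
    D = #monomials k

    1≤k : 1 ≤ k
    1≤k = <⇒≤ 2≤k

    m≤D : ∀ m → m ≤ D m
    m≤D m = <⇒≤ (#monomials-lower 1≤k m)

  -- `s` is left open so that either degree can be inserted. The last hypothesis is the threshold of
  -- `linear<2^` for c equal to the denominator of ε times q²; as q ≥ 2, the resulting power of 2
  -- may be replaced by q ^ s.
  density-close : ∀ {ε} → 0ℚ ℚ.< ε → ∀ {m n s} → m ⊓ n ≤ s → s ≤ D m + D n →
    (∀ d → 1 ≤ d → d ≤ m → d ≤ n → (D d + (D (m ∸ d) + D (n ∸ d))) + s ≤ D m + D n) →
    ℚ.↧ₙ ε * (q * q) + ℚ.↧ₙ ε * (q * q) * (ℚ.↧ₙ ε * (q * q)) ≤ s →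
    ℚ.∣ density m n ℚ.- 1ℚ ∣ ℚ.< ε
  density-close {ε} 0<ε {m} {n} {s} m⊓n≤s s≤D+D exponents large =
    ∣P/X-1∣<ε 0<ε {P m n} {N m * N n} {{m*n≢0 (N m) (N n) {{N-nonZero m}} {{N-nonZero n}}}}
      (P≤N*N F size-F finite-𝒩 finite-𝒫 m n)
      (defect-small q {s} {E} {D m} {D n} (ℚ.↧ₙ ε)
        (q^#monomials≤q*N F size-F finite-𝒩 finite-𝒫 1≤k m)
        (q^#monomials≤q*N F size-F finite-𝒩 finite-𝒫 1≤k n)
        (m∸n+n≡m s≤D+D) {{N-nonZero m}} {{N-nonZero n}}
        (N*N≤P+factors F size-F finite-𝒩 finite-𝒫 m⊓n≤s
          (λ d 1≤d d≤m d≤n → m+n≤o⇒m≤o∸n _ (exponents d 1≤d d≤m d≤n)))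
        (<-≤-trans (linear<2^ (ℚ.↧ₙ ε * (q * q)) large) (^-monoˡ-≤ s (2≤size F size-F))))
    where
    E : ℕ
    -- The subtraction is exact by `s≤D+D`, so E + s restores D(m) + D(n).
    E = D m + D n ∸ s

  density→1 : Tends density 1ℚ
  -- If m + n ≥ 2M, then one of the degrees is at least M, and that one serves as `s`.
  density→1 ε 0<ε = M + M , λ m n 2M≤m+n → close m n (M ≤? m) 2M≤m+n
    where
    C M : ℕ
    C = ℚ.↧ₙ ε * (q * q)
    M = C + C * C

    close : ∀ m n → Dec (M ≤ m) → M + M ≤ m + n → ℚ.∣ density m n ℚ.- 1ℚ ∣ ℚ.< ε
    close m n (yes M≤m) _ = density-close 0<ε (m⊓n≤m m n) (≤-trans (m≤D m) (m≤m+n (D m) (D n)))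
      (λ d → #monomials-factor 2≤k) M≤m
    -- Here n ≥ M. Since `#monomials-factor` saves its first degree, it is applied with m and n
    -- exchanged.
    close m n (no M≰m) 2M≤m+n = density-close 0<ε (m⊓n≤n m n) (≤-trans (m≤D n) (m≤n+m (D n) (D m)))
      (λ d 1≤d d≤m d≤n → subst₂ (λ x y → (D d + x) + n ≤ y) (+-comm (D (n ∸ d)) (D (m ∸ d))) (+-comm (D n) (D m))
        (#monomials-factor 2≤k 1≤d d≤n d≤m))
      (≮⇒≥ λ n<M → <⇒≱ (+-mono-< (≰⇒> M≰m) n<M) 2M≤m+n)

theorem4p1 : ∀ {c ℓ} (q : ℕ) → PrimePower q →
    (F : Field c ℓ) → HasSize (Field.setoid F) q →
    (k : ℕ) (2≤k : 2 ≤ k) →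
    Σ[ finite-𝒩 ∈ (∀ m → Finite (Polynomials.𝒩 F k m)) ]
    Σ[ finite-𝒫 ∈ (∀ m n → Finite (Polynomials.𝒫 F k m n)) ]
    Tends (Density.density F 2≤k finite-𝒩 finite-𝒫) 1ℚ
theorem4p1 q _ F size-F k 2≤k =
  finite-𝒩 F size-F , finite-𝒫 F size-F ,
  density→1 F size-F 2≤k (finite-𝒩 F size-F) (finite-𝒫 F size-F)
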